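{- For any fixed natural number $k$, the family of all graphs $G$ such that $G$ is $k$-creature-free, $G$ contains no $k$-skinny-ladder as an induced minor, and no minimal separator of $G$ contains a clique of size $k$, is tame.
   Context: All graphs are finite, simple and undirected. $N_G(X)$ denotes the open neighborhood of a vertex set $X$. Two disjoint vertex sets are anti-complete if there is no edge between them. Minimal separator of $G$: a non-empty $S\subseteq V(G)$ such that $G-S$ has at least two distinct connected components $L,R$ with $N_G(L)=N_G(R)=S$. A family $\mathcal F$ is tame if there is a constant $c$ such that every $G\in\mathcal F$ has at most $|V(G)|^c$ minimal separators. $k$-creature: a tuple $(A,B,\{x_1,\dots,x_k\},\{y_1,\dots,y_k\})$ of mutually disjoint vertex subsets of $V(G)$ (with the $x_i$ distinct and the $y_i$ distinct) such that (i) $G[A]$ and $G[B]$ are connected and $A$ is anti-complete with $B$; (ii) for every $i$, $x_iy_i\in E(G)$, $x_i$ has a neighbor in $A$ and no neighbor in $B$, and $y_i$ has a neighbor in $B$ and no neighbor in $A$; (iii) for $i\ne j$, $x_iy_j\notin E(G)$. $G$ is $k$-creature-free if it contains no $k$-creature. $k$-skinny-ladder: the graph with vertex set $\{\ell_1,\dots,\ell_k\}\cup\{s_1,\dots,s_k\}\cup\{r_1,\dots,r_k\}$ whose edges are exactly $\ell_i\ell_{i+1}$ and $r_ir_{i+1}$ for $1\le i<k$, and $\ell_is_i$ and $s_ir_i$ for $1\le i\le k$. A graph $H$ is an induced minor of $G$ if $H$ can be obtained from $G$ by vertex deletions and edge contractions. -}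

module Defs where

open import Data.Fin.Base using (Fin; toℕ; punchIn; punchOut)
open import Data.Fin.Properties using (_≟_; any?)
open import Data.Fin.Subset using (Subset; _∈_; _∉_; _⊆_; _∩_; ∁; ∣_∣; Nonempty; Empty)
open import Data.List.Base using (length)
open import Data.List.Relation.Unary.All using (All)
open import Data.List.Relation.Unary.Unique.Propositional using (Unique)
open import Data.Nat.Base using (ℕ; suc; _^_; _≤_)
import Data.Nat.Properties as ℕ
open import Data.Product.Base using (∃; ∃₂; _×_; _,_)
open import Function.Base using (_∘_)
open import Function.Bundles using (_↔_; _⇔_; Inverse)
open import Function.Definitions using (Injective)
open import Level using (0ℓ)
open import Relation.Binary.Construct.Closure.ReflexiveTransitive using (Star)
open import Relation.Binary.Construct.Closure.Symmetric using (SymClosure; fwd; bwd; symmetric)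
open import Relation.Binary.Core using (Rel)
open import Relation.Binary.Definitions using (Decidable; Symmetric; Irreflexive)
open import Relation.Binary.PropositionalEquality using (_≡_; _≢_; refl; sym; cong)
open import Relation.Nullary using (¬_; yes; no; ¬?)
open import Relation.Nullary.Decidable using (map′; _×-dec_; _⊎-dec_)
open import Data.Sum.Base using (inj₁; inj₂)
open import Relation.Unary using (Pred; _≐_)

-- Simple undirected graphs on V.  Finite graphs are taken on Fin n; for
-- them, decidable adjacency amounts to an adjacency matrix.
record Graph (V : Set) : Set₁ where
  field
    _~_      : Rel V 0ℓ
    _~?_     : Decidable _~_
    ~-sym    : Symmetric _~_
    ~-irrefl : Irreflexive _≡_ _~_

module _ {n : ℕ} (G : Graph (Fin n)) where
  open Graph G

  N : Subset n → Pred (Fin n) 0ℓ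
  N X v = v ∉ X × ∃ λ u → u ∈ X × u ~ v

  AntiComplete : Subset n → Subset n → Set
  AntiComplete X Y = ∀ {u v} → u ∈ X → v ∈ Y → ¬ (u ~ v)

  HasNeighborIn : Fin n → Subset n → Set
  HasNeighborIn v X = ∃ λ u → u ∈ X × v ~ u

  IsClique : Subset n → Set
  IsClique K = ∀ {u v} → u ∈ K → v ∈ K → u ≢ v → u ~ v

  -- Adjacency in the induced subgraph G[X].
  InducedAdj : Subset n → Rel (Fin n) 0ℓ
  InducedAdj X u v = u ∈ X × v ∈ X × u ~ v

  -- Connectedness of G[X]; the null graph is not counted as connected.
  Connected : Subset n → Set
  Connected X = Nonempty X × (∀ {u v} → u ∈ X → v ∈ X → Star (InducedAdj X) u v)

  -- C is (the vertex set of) a connected component of G[X].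
  record IsComponent (X C : Subset n) : Set where
    field
      C⊆X       : C ⊆ X
      connected : Connected C
      maximal   : ∀ {C′} → C ⊆ C′ → C′ ⊆ X → Connected C′ → C′ ⊆ C

  record IsMinimalSeparator (S : Subset n) : Set where
    field
      nonempty    : Nonempty S
      L R         : Subset n
      L-component : IsComponent (∁ S) L
      R-component : IsComponent (∁ S) R
      L≢R         : L ≢ R
      N[L]≐S      : N L ≐ (_∈ S)
      N[R]≐S      : N R ≐ (_∈ S)

  record Creature (k : ℕ) : Set where
    field
      A B         : Subset n
      x y         : Fin k → Fin n
      x-injective : Injective _≡_ _≡_ x
      y-injective : Injective _≡_ _≡_ y

      A∩B=∅ : Empty (A ∩ B)
      x∉A   : ∀ i → x i ∉ A
      x∉B   : ∀ i → x i ∉ B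
      y∉A   : ∀ i → y i ∉ A
      y∉B   : ∀ i → y i ∉ B
      x≢y   : ∀ i j → x i ≢ y j

      A-connected  : Connected A
      B-connected  : Connected B
      antiComplete : AntiComplete A B

      x~y     : ∀ i → x i ~ y i
      x-nbr-A : ∀ i → HasNeighborIn (x i) A
      x-non-B : ∀ i → ¬ HasNeighborIn (x i) B
      y-nbr-B : ∀ i → HasNeighborIn (y i) B
      y-non-A : ∀ i → ¬ HasNeighborIn (y i) A

      x≁y : ∀ {i j} → i ≢ j → ¬ (x i ~ y j)

  CreatureFree : ℕ → Set
  CreatureFree k = ¬ Creature k

  NoSeparatorContainsClique : ℕ → Set
  NoSeparatorContainsClique k =
    ∀ {S} → IsMinimalSeparator S → ¬ (∃ λ K → K ⊆ S × ∣ K ∣ ≡ k × IsClique K)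

record _≅_ {V W : Set} (G : Graph V) (H : Graph W) : Set where
  private
    module G = Graph G
    module H = Graph H
  field
    bijection : V ↔ W
    adjacency : ∀ u v → u G.~ v ⇔ Inverse.to bijection u H.~ Inverse.to bijection v

deleteVertex : ∀ {n} → Graph (Fin (suc n)) → Fin (suc n) → Graph (Fin n)
deleteVertex G v = record
  { _~_      = λ a b → punchIn v a ~ punchIn v b
  ; _~?_     = λ a b → punchIn v a ~? punchIn v b
  ; ~-sym    = ~-sym
  ; ~-irrefl = ~-irrefl ∘ cong (punchIn v)
  }
  where open Graph G

-- The quotient map Fin (suc n) → Fin n that identifies v with u and is
-- injective otherwise.
merge : ∀ {n} {u v : Fin (suc n)} → v ≢ u → Fin (suc n) → Fin n
merge {v = v} v≢u w with v ≟ w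
... | yes _  = punchOut v≢u
... | no v≢w = punchOut v≢w

contractEdge : ∀ {n} (G : Graph (Fin (suc n))) {u v : Fin (suc n)} →
               Graph._~_ G u v → Graph (Fin n)
contractEdge {n} G {u} {v} u~v = record
  { _~_      = λ p q → p ≢ q × ∃₂ λ a b → π a ≡ p × π b ≡ q × a ~ b
  ; _~?_     = λ p q → ¬? (p ≟ q) ×-dec
                 any? λ a → any? λ b → π a ≟ p ×-dec π b ≟ q ×-dec a ~? b
  ; ~-sym    = λ { (p≢q , a , b , πa≡p , πb≡q , a~b) →
                   p≢q ∘ sym , b , a , πb≡q , πa≡p , ~-sym a~b }
  ; ~-irrefl = λ { p≡q (p≢q , _) → p≢q p≡q }
  }
  where
  open Graph G
  π : Fin (suc n) → Fin n
  π = merge (λ v≡u → ~-irrefl (sym v≡u) u~v)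

data InducedMinor {W : Set} (H : Graph W) : ∀ {n} → Graph (Fin n) → Set₁ where
  iso      : ∀ {n} {G : Graph (Fin n)} → H ≅ G → InducedMinor H G
  delete   : ∀ {n} {G : Graph (Fin (suc n))} (v : Fin (suc n)) →
             InducedMinor H (deleteVertex G v) → InducedMinor H G
  contract : ∀ {n} {G : Graph (Fin (suc n))} {u v : Fin (suc n)} (u~v : Graph._~_ G u v) →
             InducedMinor H (contractEdge G u~v) → InducedMinor H G

data LadderVertex (k : ℕ) : Set where
  ℓ s r : Fin k → LadderVertex k

data LadderEdge {k : ℕ} : Rel (LadderVertex k) 0ℓ where
  ℓℓ : ∀ {i j} → toℕ j ≡ suc (toℕ i) → LadderEdge (ℓ i) (ℓ j)
  rr : ∀ {i j} → toℕ j ≡ suc (toℕ i) → LadderEdge (r i) (r j)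
  ℓs : ∀ i → LadderEdge (ℓ i) (s i)
  sr : ∀ i → LadderEdge (s i) (r i)

ladderEdge? : ∀ {k} → Decidable (LadderEdge {k})
ladderEdge? (ℓ i) (ℓ j) = map′ ℓℓ (λ { (ℓℓ e) → e }) (toℕ j ℕ.≟ suc (toℕ i))
ladderEdge? (ℓ i) (s j) = map′ (λ { refl → ℓs i }) (λ { (ℓs _) → refl }) (i ≟ j)
ladderEdge? (ℓ i) (r j) = no λ ()
ladderEdge? (s i) (ℓ j) = no λ ()
ladderEdge? (s i) (s j) = no λ ()
ladderEdge? (s i) (r j) = map′ (λ { refl → sr i }) (λ { (sr _) → refl }) (i ≟ j)
ladderEdge? (r i) (ℓ j) = no λ ()
ladderEdge? (r i) (s j) = no λ ()
ladderEdge? (r i) (r j) = map′ rr (λ { (rr e) → e }) (toℕ j ℕ.≟ suc (toℕ i))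

ladderEdge-irrefl : ∀ {k} {v : LadderVertex k} → ¬ LadderEdge v v
ladderEdge-irrefl (ℓℓ e) = ℕ.1+n≢n (sym e)
ladderEdge-irrefl (rr e) = ℕ.1+n≢n (sym e)

skinnyLadder : ∀ k → Graph (LadderVertex k)
skinnyLadder k = record
  { _~_      = SymClosure LadderEdge
  ; _~?_     = λ u v → map′ (λ { (inj₁ e) → fwd e ; (inj₂ e) → bwd e })
                            (λ { (fwd e) → inj₁ e ; (bwd e) → inj₂ e })
                            (ladderEdge? u v ⊎-dec ladderEdge? v u)
  ; ~-sym    = symmetric LadderEdge
  ; ~-irrefl = λ { refl (fwd e) → ladderEdge-irrefl e
                 ; refl (bwd e) → ladderEdge-irrefl e }
  }

GraphFamily : Set₂
GraphFamily = ∀ {n} → Graph (Fin n) → Set₁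

-- At most m elements satisfy P: every repetition-free list of such
-- elements has length at most m.
AtMost : {A : Set} → ℕ → Pred A 0ℓ → Set
AtMost m P = ∀ xs → Unique xs → All P xs → length xs ≤ m

Tame : GraphFamily → Set₁
Tame F = ∃ λ c → ∀ {n} (G : Graph (Fin n)) → F G → AtMost (n ^ c) (IsMinimalSeparator G)

{-# OPTIONS --safe #-}
-- Let L and R be full components of a minimal separator S.
--
-- S is dominated by boundedly many vertices of L ∪ R ∪ S.  Grow a connected C ⊆ L until a large,
-- that is not boundedly dominated, part of S is attached to it.  Without a k-creature the neighbours
-- of C dominate boundedly, and boundedly many components of L beyond them cover the rest of S, so
-- one of these, D, is again attached to a large part.  If a large part is attached to both C and D,
-- then L has been replaced by two sets; with k + 1 pairwise apart connected sets attached to the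
-- same large part there is a k-creature.  Otherwise C and D are attached to disjoint large parts, and
-- continuing in D yields an induced path of connected sets with private large parts.  The same
-- growth in R, for all these parts at once, yields a second path; the orders of the parts along both
-- paths agree, or are opposite, on a long subsequence (Erdős–Szekeres), which is a ladder.
--
-- As S has no clique of size k, dominators in S can be replaced, by induction on the clique number,
-- by boundedly many dominators in L ∪ R.  So S is a union of boundedly many traces S ∩ N(x) with
-- x ∈ L (or R).  For fixed x ∈ L and y ∈ R the number of such traces is polynomial: by a lemma of
-- Sauer–Shelah type, otherwise there are k neighbours of x whose intersections with suitable traces
-- are empty and all the singletons, and then the y-sides of these separators and x form a k-creature.

module Submission where

open import Defs
import Data.Bool.Properties as Bool
open import Data.Fin.Base as Fin using (Fin; zero; suc; toℕ)
open import Data.Fin.Properties as Fin using (_≟_; any?)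
open import Data.Fin.Subset
open import Data.Fin.Subset.Induction using (⊃-wellFounded; Acc; acc)
open import Data.Fin.Subset.Properties
open import Data.List.Base as List using (List; []; _∷_; length; _++_; filter; map)
import Data.List.Membership.DecPropositional as DecMem
open import Data.List.Membership.Propositional using (find) renaming (_∈_ to _∈ˡ_)
import Data.List.Membership.Propositional.Properties as Mem
import Data.List.Properties as List
import Data.List.Relation.Binary.Sublist.Propositional.Properties as Sub
open import Data.List.Relation.Unary.All as All using (All; []; _∷_)
import Data.List.Relation.Unary.All.Properties as All
open import Data.List.Relation.Unary.AllPairs using (AllPairs; []; _∷_)
open import Data.List.Relation.Unary.Any as Any using (Any; here; there)
import Data.List.Relation.Unary.Any.Properties as Any
import Data.List.Relation.Unary.Unique.DecPropositional.Properties as DecUnique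
open import Data.List.Relation.Unary.Unique.Propositional using (Unique)
import Data.List.Relation.Unary.Unique.Propositional.Properties as Unique
open import Data.Maybe.Base using (Maybe; just; nothing)
open import Data.Maybe.Properties as Maybe using (just-injective)
open import Data.Nat.Base using (ℕ; zero; suc; _+_; _*_; _∸_; _^_; _≤_; _<_; _>_; z≤n; s≤s; s≤s⁻¹)
import Data.Nat.Properties as ℕ
open import Data.Product.Base using (∃; ∃₂; _×_; _,_; proj₁; proj₂; swap)
open import Data.Sum.Base using (_⊎_; inj₁; inj₂; [_,_]′)
open import Data.Unit.Base using (tt) renaming (⊤ to Unit)
import Data.Vec.Base as Vec
open import Data.Vec.Properties as Vec using (lookup∘tabulate; lookup⇒[]=; []=⇒lookup)
open import Function.Base using (_∘_; id; case_of_)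
open import Function.Bundles using (mk↔ₛ′; mk⇔)
open import Level using (0ℓ)
open import Relation.Binary.Construct.Closure.ReflexiveTransitive as Star using (Star; ε; _◅_; _◅◅_)
open import Relation.Binary.Construct.Closure.Symmetric using (SymClosure; fwd; bwd)
open import Relation.Binary.Core using (Rel)
open import Relation.Binary.Definitions using (DecidableEquality; Symmetric; tri<; tri≈; tri>)
open import Relation.Binary.PropositionalEquality
  using (_≡_; _≢_; refl; sym; trans; cong; subst; subst₂; module ≡-Reasoning)
open import Relation.Nullary using (¬_; Dec; yes; no; ¬?; does; contradiction)
open import Relation.Nullary.Decidable using (_×-dec_; _⊎-dec_; dec-true; decidable-stable; map′)
open import Relation.Unary using (Pred; Decidable)

-- Subsets of a finite set given by decidable predicates, with rules for the set operations.

module _ {n : ℕ} where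

  ⟪_⟫ : {P : Pred (Fin n) 0ℓ} → Decidable P → Subset n
  ⟪ P? ⟫ = Vec.tabulate (does ∘ P?)

  ∈⟪⟫⁺ : ∀ {P : Pred (Fin n) 0ℓ} (P? : Decidable P) {x} → P x → x ∈ ⟪ P? ⟫
  ∈⟪⟫⁺ P? {x} px = lookup⇒[]= x _ (trans (lookup∘tabulate (does ∘ P?) x) (dec-true (P? x) px))

  ∈⟪⟫⁻ : ∀ {P : Pred (Fin n) 0ℓ} (P? : Decidable P) {x} → x ∈ ⟪ P? ⟫ → P x
  ∈⟪⟫⁻ P? {x} x∈ with P? x | trans (sym (lookup∘tabulate (does ∘ P?) x)) ([]=⇒lookup x∈)
  ... | yes px | _ = px

  infixl 5 _∖_
  _∖_ : Subset n → Subset n → Subset n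
  X ∖ Y = X ∩ ∁ Y

  ∖⁺ : ∀ {X Y x} → x ∈ X → x ∉ Y → x ∈ X ∖ Y
  ∖⁺ x∈X x∉Y = x∈p∩q⁺ (x∈X , x∉p⇒x∈∁p x∉Y)

  ∖⁻ : ∀ {X Y x} → x ∈ X ∖ Y → x ∈ X × x ∉ Y
  ∖⁻ {X} {Y} x∈ = let x∈X , x∈∁Y = x∈p∩q⁻ X (∁ Y) x∈ in x∈X , x∈∁p⇒x∉p x∈∁Y

  ∩⁺ : ∀ {X Y : Subset n} {x} → x ∈ X → x ∈ Y → x ∈ X ∩ Y
  ∩⁺ x∈X x∈Y = x∈p∩q⁺ (x∈X , x∈Y)

  ∩⁻ : ∀ {X Y : Subset n} {x} → x ∈ X ∩ Y → x ∈ X × x ∈ Y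
  ∩⁻ {X} {Y} = x∈p∩q⁻ X Y

  ∪ˡ : ∀ {X Y : Subset n} {x} → x ∈ X → x ∈ X ∪ Y
  ∪ˡ {Y = Y} = p⊆p∪q Y

  ∪ʳ : ∀ {X Y : Subset n} {x} → x ∈ Y → x ∈ X ∪ Y
  ∪ʳ {X} {Y} = q⊆p∪q X Y

  ∪-elim : ∀ {X Y : Subset n} {x} {A : Set} → (x ∈ X → A) → (x ∈ Y → A) → x ∈ X ∪ Y → A
  ∪-elim {X} {Y} f g = [ f , g ]′ ∘ x∈p∪q⁻ X Y

  ∪-lub : ∀ {X Y Z : Subset n} → X ⊆ Z → Y ⊆ Z → X ∪ Y ⊆ Z
  ∪-lub f g x∈ = ∪-elim f g x∈

  ∈⁅⁆⁻ : ∀ {x y : Fin n} → x ∈ ⁅ y ⁆ → x ≡ y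
  ∈⁅⁆⁻ {y = y} = x∈⁅y⁆⇒x≡y y

  ⁅⁆-elim : ∀ {x y : Fin n} (P : Fin n → Set) → P y → x ∈ ⁅ y ⁆ → P x
  ⁅⁆-elim P py x∈ = subst P (sym (∈⁅⁆⁻ x∈)) py

  ⁅⁆⊆ : ∀ {x : Fin n} {X} → x ∈ X → ⁅ x ⁆ ⊆ X
  ⁅⁆⊆ {X = X} x∈X = ⁅⁆-elim (_∈ X) x∈X


-- Counting in lists.

module _ {A : Set} where

  lookup-pairs : ∀ {R : Rel A 0ℓ} → Symmetric R → ∀ {xs} → AllPairs R xs →
                 ∀ {i j} → i ≢ j → R (List.lookup xs i) (List.lookup xs j)
  lookup-pairs R-sym (_ ∷ _)   {zero}  {zero}  i≢j = contradiction refl i≢j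
  lookup-pairs R-sym (rs ∷ _)  {zero}  {suc j} _   = All.lookup rs (Mem.∈-lookup j)
  lookup-pairs R-sym (rs ∷ _)  {suc i} {zero}  _   = R-sym (All.lookup rs (Mem.∈-lookup i))
  lookup-pairs R-sym (_ ∷ rss) {suc i} {suc j} i≢j = lookup-pairs R-sym rss (i≢j ∘ cong suc)

  unique-⊆⇒length≤ : ∀ {xs ys : List A} → Unique xs → (∀ {x} → x ∈ˡ xs → x ∈ˡ ys) → length xs ≤ length ys
  unique-⊆⇒length≤ {xs} {ys} unique sub = Fin.injective⇒≤ {f = position} λ {i} {j} eq →
    decidable-stable (i ≟ j) λ i≢j → lookup-pairs (_∘ sym) unique i≢j
      (trans (Any.lookup-index (found i)) (trans (cong (List.lookup ys) eq) (sym (Any.lookup-index (found j)))))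
    where
    found : ∀ i → List.lookup xs i ∈ˡ ys
    found i = sub (Mem.∈-lookup i)
    position : Fin (length xs) → Fin (length ys)
    position i = Any.index (found i)

  length-filter-split : ∀ {P : Pred A 0ℓ} (P? : Decidable P) xs →
    length xs ≡ length (filter P? xs) + length (filter (¬? ∘ P?) xs)
  length-filter-split P? [] = refl
  length-filter-split P? (x ∷ xs) with P? x
  ... | yes _ = cong suc (length-filter-split P? xs)
  ... | no _  = trans (cong suc (length-filter-split P? xs)) (sym (ℕ.+-suc _ _))

  -- If `b` holds fewer than `q` elements, discarding these leaves more than `q` times the number of
  -- remaining bins. Bins may overlap, so putting the discarded elements back can only increase the
  -- count found.
  pigeonhole : ∀ {B : Set} {P : B → A → Set} (P? : ∀ b → Decidable (P b)) q (bs : List B) (xs : List A) →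
    All (λ x → Any (λ b → P b x) bs) xs → length bs * q < length xs →
    ∃ λ b → b ∈ˡ bs × q ≤ length (filter (P? b) xs)
  pigeonhole P? q [] (x ∷ xs) (() ∷ _) lt
  pigeonhole {P = P} P? q (b ∷ bs) xs all lt with q ℕ.≤? length (filter (P? b) xs)
  ... | yes q≤ = b , here refl , q≤
  ... | no q≰ =
    let b′ , b′∈ , q≤ = pigeonhole P? q bs rest rest-all (ℕ.+-cancelˡ-< q _ _ rest-long)
    in b′ , there b′∈ , ℕ.≤-trans q≤ (mono b′ xs)
    where
    rest : List A
    rest = filter (¬? ∘ P? b) xs
    rest-all : All (λ x → Any (λ b → P b x) bs) rest
    rest-all = All.tabulate λ x∈ → let x∈xs , ¬p = Mem.∈-filter⁻ (¬? ∘ P? b) {xs = xs} x∈ in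
      case All.lookup all x∈xs of λ { (here p) → contradiction p ¬p ; (there any) → any }
    rest-long : q + length bs * q < q + length rest
    rest-long = ℕ.<-≤-trans lt (ℕ.≤-trans (ℕ.≤-reflexive (length-filter-split (P? b) xs))
      (ℕ.+-monoˡ-≤ (length rest) (ℕ.<⇒≤ (ℕ.≰⇒> q≰))))
    mono : ∀ b′ xs → length (filter (P? b′) (filter (¬? ∘ P? b) xs)) ≤ length (filter (P? b′) xs)
    mono b′ xs = Sub.length-mono-≤ (Sub.filter⁺ (P? b′) (P? b′) (λ { refl p → p }) (Sub.filter-⊆ (¬? ∘ P? b) xs))

  length≤1+filter : ∀ {P : Pred A 0ℓ} (P? : Decidable P) {y} → (∀ {x} → x ≢ y → P x) → ∀ {xs} → Unique xs →
    length xs ≤ suc (length (filter P? xs))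
  length≤1+filter P? {y} P-others [] = z≤n
  length≤1+filter P? {y} P-others {x ∷ xs} (x∉ ∷ u) with P? x
  ... | yes _ = s≤s (length≤1+filter P? P-others u)
  ... | no ¬p = s≤s (ℕ.≤-reflexive (sym (cong length (List.filter-all P?
    (All.map (λ x≢z → P-others λ z≡y → ¬p (P-others λ x≡y → x≢z (trans x≡y (sym z≡y)))) x∉)))))

-- Minor models

-- `φ` labels each vertex with its branch set, `nothing` marking the vertices to be deleted. A
-- labelling restricts along `Fin.punchIn` whenever a vertex is deleted or merged.
record MinorModel {W : Set} (H : Graph W) {n} (G : Graph (Fin n)) (φ : Fin n → Maybe W) : Set where
  private
    module H = Graph H
    module G = Graph G
  InFibre : W → Rel (Fin n) 0ℓ
  InFibre h a b = a G.~ b × φ a ≡ just h × φ b ≡ just h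
  field
    surjective : ∀ h → ∃ λ u → φ u ≡ just h
    connected  : ∀ {u v h} → φ u ≡ just h → φ v ≡ just h → Star (InFibre h) u v
    edge⁺      : ∀ {h h′} → h H.~ h′ → ∃₂ λ u v → φ u ≡ just h × φ v ≡ just h′ × u G.~ v
    edge⁻      : ∀ {u v h h′} → φ u ≡ just h → φ v ≡ just h′ → h ≢ h′ → u G.~ v → h H.~ h′

merge-punchIn : ∀ {n} {u v : Fin (suc n)} (v≢u : v ≢ u) a → merge v≢u (Fin.punchIn v a) ≡ a
merge-punchIn {v = v} v≢u a with v ≟ Fin.punchIn v a
... | yes v≡ = contradiction (sym v≡) (Fin.punchInᵢ≢i v a)
... | no v≢  = trans (Fin.punchOut-cong v refl) (Fin.punchOut-punchIn v {a})

module _ {W : Set} {H : Graph W} where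
  private module H = Graph H

  model-delete : ∀ {n} {G : Graph (Fin (suc n))} {φ} {x} → φ x ≡ nothing → MinorModel H G φ →
                 MinorModel H (deleteVertex G x) (φ ∘ Fin.punchIn x)
  model-delete {n} {G} {φ} {x} φx model = record
    { surjective = λ h → let u , φu = surjective h in
        Fin.punchOut (avoid φu) , trans (cong φ (Fin.punchIn-punchOut (avoid φu))) φu
    ; connected = λ {u} {v} φu φv → subst₂ (Star _) (Fin.punchOut-punchIn x) (Fin.punchOut-punchIn x)
        (walk (connected φu φv) (avoid φu ) (avoid φv))
    ; edge⁺ = λ h~h′ → let u , v , φu , φv , u~v = edge⁺ h~h′ in
        Fin.punchOut (avoid φu) , Fin.punchOut (avoid φv)
        , trans (cong φ (Fin.punchIn-punchOut (avoid φu))) φu , trans (cong φ (Fin.punchIn-punchOut (avoid φv))) φv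
        , subst₂ _~_ (sym (Fin.punchIn-punchOut (avoid φu))) (sym (Fin.punchIn-punchOut (avoid φv))) u~v
    ; edge⁻ = edge⁻
    }
    where
    open MinorModel model
    open Graph G
    avoid : ∀ {u h} → φ u ≡ just h → x ≢ u
    avoid φu refl with trans (sym φx) φu
    ... | ()
    walk : ∀ {h u v} → Star (InFibre h) u v → (x≢u : x ≢ u) (x≢v : x ≢ v) →
           Star (λ a b → Graph._~_ (deleteVertex G x) a b × φ (Fin.punchIn x a) ≡ just h × φ (Fin.punchIn x b) ≡ just h)
                (Fin.punchOut x≢u) (Fin.punchOut x≢v)
    walk ε x≢u x≢v = subst (Star _ _) (Fin.punchOut-cong x refl) ε
    walk {h} {u} (_◅_ {j = z} (u~z , φu , φz) rest) x≢u x≢v =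
      ( subst₂ _~_ (sym (Fin.punchIn-punchOut x≢u)) (sym (Fin.punchIn-punchOut (avoid φz))) u~z
      , trans (cong φ (Fin.punchIn-punchOut x≢u)) φu , trans (cong φ (Fin.punchIn-punchOut (avoid φz))) φz )
      ◅ walk rest (avoid φz) x≢v

  module _ {n : ℕ} {G : Graph (Fin (suc n))} {φ : Fin (suc n) → Maybe W} where
    open Graph G

    merge-fibre : ∀ {u v} (v≢u : v ≢ u) → φ u ≡ φ v → ∀ a → φ (Fin.punchIn v (merge v≢u a)) ≡ φ a
    merge-fibre {u} {v} v≢u φu≡φv a with v ≟ a
    ... | yes refl = trans (cong φ (Fin.punchIn-punchOut v≢u)) φu≡φv
    ... | no v≢a   = cong φ (Fin.punchIn-punchOut v≢a)

    -- Both ends of the contracted edge carry the same label, so the labelling descends to the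
    -- quotient. Steps of a walk between merged vertices collapse.
    model-contract : ∀ {u v} (u~v : u ~ v) → φ u ≡ φ v → MinorModel H G φ →
                     MinorModel H (contractEdge G u~v) (φ ∘ Fin.punchIn v)
    model-contract {u} {v} u~v φu≡φv model = record
      { surjective = λ h → let a , φa = surjective h in π a , trans (φπ a) φa
      ; connected = λ {a} {b} φa φb → subst₂ (Star _) (merge-punchIn v≢u a) (merge-punchIn v≢u b) (walk (connected φa φb))
      ; edge⁺ = λ h~h′ → let a , b , φa , φb , a~b = edge⁺ h~h′ in
          π a , π b , trans (φπ a) φa , trans (φπ b) φb
          , (λ πa≡πb → H.~-irrefl (just-injective (trans (sym (trans (φπ a) φa))
              (trans (cong (φ ∘ Fin.punchIn v) πa≡πb) (trans (φπ b) φb)))) h~h′)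
          , a , b , refl , refl , a~b
      ; edge⁻ = λ { φp φq h≢h′ (_ , a , b , refl , refl , a~b) →
          edge⁻ (trans (sym (φπ a)) φp) (trans (sym (φπ b)) φq) h≢h′ a~b }
      }
      where
      open MinorModel model
      v≢u : v ≢ u
      v≢u v≡u = ~-irrefl (sym v≡u) u~v
      π : Fin (suc n) → Fin n
      π = merge v≢u
      φπ : ∀ a → φ (Fin.punchIn v (π a)) ≡ φ a
      φπ = merge-fibre v≢u φu≡φv
      walk : ∀ {h a b} → Star (InFibre h) a b →
             Star (λ p q → Graph._~_ (contractEdge G u~v) p q × φ (Fin.punchIn v p) ≡ just h × φ (Fin.punchIn v q) ≡ just h)
                  (π a) (π b)
      walk ε = ε
      walk {h} {a} {b} (_◅_ {j = c} (a~c , φa , φc) rest) with π a ≟ π c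
      ... | yes πa≡πc = subst (λ p → Star _ p (π b)) (sym πa≡πc) (walk rest)
      ... | no πa≢πc  = ((πa≢πc , a , c , refl , refl , a~c) , trans (φπ a) φa , trans (φπ c) φc) ◅ walk rest

  -- A connected fibre without an inner edge is a single vertex, so a total labelling of this kind
  -- is a bijection.
  model-bijective : ∀ {n} {G : Graph (Fin n)} {φ} → MinorModel H G φ → (∀ u → φ u ≢ nothing) →
                    (∀ {u v} → φ u ≡ φ v → ¬ Graph._~_ G u v) → InducedMinor H G
  model-bijective {n} {G} {φ} model total fibre-free = iso record
    { bijection = mk↔ₛ′ to from to-from from-to
    ; adjacency = λ h h′ → mk⇔
        (λ h~h′ → let u , v , φu , φv , u~v = edge⁺ h~h′ in
          subst₂ _~_ (injective (trans φu (sym (φ-to h)))) (injective (trans φv (sym (φ-to h′)))) u~v)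
        (λ u~v → edge⁻ (φ-to h) (φ-to h′) (λ { refl → ~-irrefl refl u~v }) u~v)
    }
    where
    open MinorModel model
    open Graph G
    value : ∀ u → ∃ λ h → φ u ≡ just h
    value u with φ u in eq
    ... | just h  = h , refl
    ... | nothing = contradiction eq (total u)
    to : W → Fin n
    to h = proj₁ (surjective h)
    φ-to : ∀ h → φ (to h) ≡ just h
    φ-to h = proj₂ (surjective h)
    from : Fin n → W
    from u = proj₁ (value u)
    injective : ∀ {u v} → φ u ≡ φ v → u ≡ v
    injective {u} {v} φu≡φv with value u
    ... | h , φu with connected φu (trans (sym φu≡φv) φu)
    ...   | ε = refl
    ...   | (u~c , φu′ , φc) ◅ _ = contradiction u~c (fibre-free (trans φu′ (sym φc)))
    to-from : ∀ u → to (from u) ≡ u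
    to-from u = injective (trans (φ-to (from u)) (sym (proj₂ (value u))))
    from-to : ∀ h → from (to h) ≡ h
    from-to h = just-injective (trans (sym (proj₂ (value (to h)))) (φ-to h))

  -- Induction on the number of vertices: delete an unlabelled vertex, otherwise contract an edge
  -- inside a fibre; when neither exists, the labelling is an isomorphism.
  model⇒minor : DecidableEquality W → ∀ {n} (G : Graph (Fin n)) φ → MinorModel H G φ → InducedMinor H G
  model⇒minor _≟ᵂ_ {zero} G φ model = model-bijective model (λ ()) (λ { {()} })
  model⇒minor _≟ᵂ_ {suc n} G φ model
    with any? (λ u → φ u ≟ᴹ nothing) | any? (λ u → any? λ v → φ u ≟ᴹ φ v ×-dec Graph._~?_ G u v)
    where
    _≟ᴹ_ : DecidableEquality (Maybe W)
    _≟ᴹ_ = Maybe.≡-dec _≟ᵂ_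
  ... | yes (x , φx) | _ = delete x (model⇒minor _≟ᵂ_ _ _ (model-delete φx model))
  ... | no _ | yes (u , v , φu≡φv , u~v) = contract u~v (model⇒minor _≟ᵂ_ _ _ (model-contract u~v φu≡φv model))
  ... | no total | no fibre-free = model-bijective model (λ u φu → total (u , φu)) (λ φ≡ u~v → fibre-free (_ , _ , φ≡ , u~v))

-- Set families

_≟ˢ_ : ∀ {n} → DecidableEquality (Subset n)
_≟ˢ_ = Vec.≡-dec Bool._≟_

-- A family without such a configuration of k points has at most (1 + n) ^ k members: a weak form
-- of the Sauer–Shelah lemma.
record Dispersed {n} (k : ℕ) (𝓕 : List (Subset n)) : Set where
  field
    z    : Fin k → Fin n
    W₀   : Subset n
    W    : Fin k → Subset n
    W₀∈𝓕 : W₀ ∈ˡ 𝓕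
    W∈𝓕  : ∀ i → W i ∈ˡ 𝓕
    z∉W₀ : ∀ i → z i ∉ W₀
    z∈W  : ∀ i → z i ∈ W i
    z∉W  : ∀ {i j} → i ≢ j → z i ∉ W j

insides outsides : ∀ {n} → List (Subset (suc n)) → List (Subset n)
insides [] = []
insides ((inside Vec.∷ p) ∷ 𝓕) = p ∷ insides 𝓕
insides ((outside Vec.∷ p) ∷ 𝓕) = insides 𝓕
outsides [] = []
outsides ((inside Vec.∷ p) ∷ 𝓕) = outsides 𝓕
outsides ((outside Vec.∷ p) ∷ 𝓕) = p ∷ outsides 𝓕

insides⁻ : ∀ {n} (𝓕 : List (Subset (suc n))) {p} → p ∈ˡ insides 𝓕 → (inside Vec.∷ p) ∈ˡ 𝓕
insides⁻ ((inside Vec.∷ p) ∷ 𝓕) (here refl) = here refl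
insides⁻ ((inside Vec.∷ p) ∷ 𝓕) (there p∈) = there (insides⁻ 𝓕 p∈)
insides⁻ ((outside Vec.∷ p) ∷ 𝓕) p∈ = there (insides⁻ 𝓕 p∈)

outsides⁻ : ∀ {n} (𝓕 : List (Subset (suc n))) {p} → p ∈ˡ outsides 𝓕 → (outside Vec.∷ p) ∈ˡ 𝓕
outsides⁻ ((inside Vec.∷ p) ∷ 𝓕) p∈ = there (outsides⁻ 𝓕 p∈)
outsides⁻ ((outside Vec.∷ p) ∷ 𝓕) (here refl) = here refl
outsides⁻ ((outside Vec.∷ p) ∷ 𝓕) (there p∈) = there (outsides⁻ 𝓕 p∈)

insides-unique : ∀ {n} {𝓕 : List (Subset (suc n))} → Unique 𝓕 → Unique (insides 𝓕)
insides-unique [] = []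
insides-unique {𝓕 = (inside Vec.∷ p) ∷ 𝓕} (p∉ ∷ u) =
  All.tabulate (λ q∈ p≡q → All.lookup p∉ (insides⁻ 𝓕 q∈) (cong (inside Vec.∷_) p≡q)) ∷ insides-unique u
insides-unique {𝓕 = (outside Vec.∷ p) ∷ 𝓕} (_ ∷ u) = insides-unique u

outsides-unique : ∀ {n} {𝓕 : List (Subset (suc n))} → Unique 𝓕 → Unique (outsides 𝓕)
outsides-unique [] = []
outsides-unique {𝓕 = (inside Vec.∷ p) ∷ 𝓕} (_ ∷ u) = outsides-unique u
outsides-unique {𝓕 = (outside Vec.∷ p) ∷ 𝓕} (p∉ ∷ u) =
  All.tabulate (λ q∈ p≡q → All.lookup p∉ (outsides⁻ 𝓕 q∈) (cong (outside Vec.∷_) p≡q)) ∷ outsides-unique u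

length-insides-outsides : ∀ {n} (𝓕 : List (Subset (suc n))) → length 𝓕 ≡ length (insides 𝓕) + length (outsides 𝓕)
length-insides-outsides [] = refl
length-insides-outsides ((inside Vec.∷ p) ∷ 𝓕) = cong suc (length-insides-outsides 𝓕)
length-insides-outsides ((outside Vec.∷ p) ∷ 𝓕) = trans (cong suc (length-insides-outsides 𝓕)) (sym (ℕ.+-suc _ _))

-- Induction on the ground set, removing its first point. `either` lists the restrictions of the
-- members, `both` those restrictions that occur with and without the point. If `either` is long,
-- the configuration is found there; otherwise `both` is long, and the point is added to a
-- configuration of `k` points in it.
dispersed : ∀ {n} k (𝓕 : List (Subset n)) → Unique 𝓕 → suc n ^ k < length 𝓕 → Dispersed k 𝓕
dispersed zero [] _ ()
dispersed zero (p ∷ 𝓕) _ _ = record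
  { z = λ () ; W₀ = p ; W = λ () ; W₀∈𝓕 = here refl ; W∈𝓕 = λ () ; z∉W₀ = λ () ; z∈W = λ () ; z∉W = λ { {()} } }
dispersed {zero} (suc k) 𝓕 unique long = contradiction
  (ℕ.<-≤-trans long (unique-⊆⇒length≤ {ys = Vec.[] ∷ []} unique λ { {Vec.[]} _ → here refl }))
  (ℕ.≤⇒≯ (ℕ.≤-reflexive (sym (ℕ.^-zeroˡ (suc k)))))
dispersed {suc n} (suc k) 𝓕 unique long = by-length (suc n ^ suc k ℕ.<? length either)
  where
  ins outs either both : List (Subset n)
  ins = insides 𝓕
  outs = outsides 𝓕
  in? : ∀ p → Dec (p ∈ˡ ins)
  in? p = DecMem._∈?_ _≟ˢ_ p ins
  either = ins ++ filter (¬? ∘ in?) outs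
  both = filter in? outs
  either-unique : Unique either
  either-unique = Unique.++⁺ (insides-unique unique) (Unique.filter⁺ (¬? ∘ in?) (outsides-unique unique))
    λ (p∈ , p∈′) → proj₂ (Mem.∈-filter⁻ (¬? ∘ in?) {xs = outs} p∈′) p∈
  both⁻ : ∀ {p} → p ∈ˡ both → p ∈ˡ outs × p ∈ˡ ins
  both⁻ = Mem.∈-filter⁻ in? {xs = outs}
  either⁻ : ∀ {p} → p ∈ˡ either → ∃ λ b → (b Vec.∷ p) ∈ˡ 𝓕
  either⁻ p∈ = [ (λ p∈ → inside , insides⁻ 𝓕 p∈)
               , (λ p∈ → outside , outsides⁻ 𝓕 (proj₁ (Mem.∈-filter⁻ (¬? ∘ in?) {xs = outs} p∈))) ]′ (Mem.∈-++⁻ ins p∈)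
  total : length 𝓕 ≡ length either + length both
  total = begin
    length 𝓕                                                            ≡⟨ length-insides-outsides 𝓕 ⟩
    length ins + length outs                                            ≡⟨ cong (length ins +_) (length-filter-split in? outs) ⟩
    length ins + (length both + length (filter (¬? ∘ in?) outs))        ≡⟨ cong (length ins +_) (ℕ.+-comm (length both) _) ⟩
    length ins + (length (filter (¬? ∘ in?) outs) + length both)        ≡⟨ sym (ℕ.+-assoc (length ins) _ _) ⟩
    length ins + length (filter (¬? ∘ in?) outs) + length both          ≡⟨ cong (_+ length both) (sym (List.length-++ ins)) ⟩
    length either + length both                                         ∎
    where open ≡-Reasoning
  from-either : Dispersed (suc k) either → Dispersed (suc k) 𝓕
  from-either δ = record
    { z = suc ∘ z ; W₀ = proj₁ (either⁻ W₀∈𝓕) Vec.∷ W₀ ; W = λ i → proj₁ (either⁻ (W∈𝓕 i)) Vec.∷ W i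
    ; W₀∈𝓕 = proj₂ (either⁻ W₀∈𝓕) ; W∈𝓕 = λ i → proj₂ (either⁻ (W∈𝓕 i))
    ; z∉W₀ = λ i → z∉W₀ i ∘ drop-there ; z∈W = λ i → Vec.there (z∈W i) ; z∉W = λ i≢j → z∉W i≢j ∘ drop-there }
    where open Dispersed δ
  from-both : Dispersed k both → Dispersed (suc k) 𝓕
  from-both δ = record
    { z = λ { zero → zero ; (suc i) → suc (z i) }
    -- The new point distinguishes two members with the same restriction `W₀`: without the point it
    -- remains the empty intersection, with the point it picks out the new point alone.
    ; W₀ = outside Vec.∷ W₀ ; W = λ { zero → inside Vec.∷ W₀ ; (suc i) → outside Vec.∷ W i }
    ; W₀∈𝓕 = outsides⁻ 𝓕 (proj₁ (both⁻ W₀∈𝓕))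
    ; W∈𝓕 = λ { zero → insides⁻ 𝓕 (proj₂ (both⁻ W₀∈𝓕)) ; (suc i) → outsides⁻ 𝓕 (proj₁ (both⁻ (W∈𝓕 i))) }
    ; z∉W₀ = λ { zero () ; (suc i) → z∉W₀ i ∘ drop-there }
    ; z∈W = λ { zero → Vec.here ; (suc i) → Vec.there (z∈W i) }
    ; z∉W = λ { {zero} {zero} i≢j _ → i≢j refl ; {zero} {suc j} _ () ; {suc i} {zero} _ → z∉W₀ i ∘ drop-there
              ; {suc i} {suc j} i≢j → z∉W (i≢j ∘ cong suc) ∘ drop-there } }
    where open Dispersed δ
  by-length : Dec (suc n ^ suc k < length either) → Dispersed (suc k) 𝓕
  by-length (yes many) = from-either (dispersed (suc k) either either-unique many)
  by-length (no few) = from-both (dispersed k both (Unique.filter⁺ in? (outsides-unique unique))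
    (ℕ.+-cancelˡ-< (suc n ^ suc k) _ _ (begin-strict
      -- A Pascal-type recurrence: the bound for `suc n` and `suc k` leaves room for the bounds of
      -- both recursive calls.
      suc n ^ suc k + suc n ^ k         ≡⟨ ℕ.+-comm (suc n ^ suc k) _ ⟩
      suc (suc n) * suc n ^ k           ≤⟨ ℕ.*-monoʳ-≤ (suc (suc n)) (ℕ.^-monoˡ-≤ k (ℕ.n≤1+n (suc n))) ⟩
      suc (suc n) ^ suc k               <⟨ long ⟩
      length 𝓕                          ≡⟨ total ⟩
      length either + length both       ≤⟨ ℕ.+-monoˡ-≤ (length both) (ℕ.≮⇒≥ few) ⟩
      suc n ^ suc k + length both       ∎)))
    where open ℕ.≤-Reasoning

-- Unions of boundedly many sets.

unions : ∀ {n} → ℕ → List (Subset n) → List (Subset n)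
unions zero    𝒲 = ⊥ ∷ []
unions (suc m) 𝒲 = List.concatMap (λ V → map (V ∪_) (unions m 𝒲)) 𝒲

length-concatMap : ∀ {A B : Set} {f : A → List B} {m} xs → (∀ x → length (f x) ≤ m) → length (List.concatMap f xs) ≤ length xs * m
length-concatMap [] _ = z≤n
length-concatMap {f = f} (x ∷ xs) bound = ℕ.≤-trans (ℕ.≤-reflexive (List.length-++ (f x)))
  (ℕ.+-mono-≤ (bound x) (length-concatMap xs bound))

length-unions : ∀ {n} m (𝒲 : List (Subset n)) → length (unions m 𝒲) ≤ length 𝒲 ^ m
length-unions zero    𝒲 = ℕ.≤-refl
length-unions (suc m) 𝒲 = length-concatMap 𝒲 λ V →
  ℕ.≤-trans (ℕ.≤-reflexive (List.length-map (V ∪_) (unions m 𝒲))) (length-unions m 𝒲)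

-- `unions m` takes exactly `m` members with repetition, so shorter unions are padded with `⊥`.
∈-unions : ∀ {n m} {𝒲 : List (Subset n)} → ⊥ ∈ˡ 𝒲 → ∀ Vs → All (_∈ˡ 𝒲) Vs → length Vs ≤ m → ⋃ Vs ∈ˡ unions m 𝒲
∈-unions {m = zero} _ [] [] _ = here refl
∈-unions {m = suc m} {𝒲} ⊥∈ [] [] _ = Mem.∈-concatMap⁺ _ (Any.map
  (λ { refl → subst (_∈ˡ map (⊥ ∪_) (unions m 𝒲)) (∪-identityˡ _) (Mem.∈-map⁺ (⊥ ∪_) (∈-unions {m = m} ⊥∈ [] [] z≤n)) }) ⊥∈)
∈-unions {m = suc m} {𝒲} ⊥∈ (V ∷ Vs) (V∈ ∷ Vs∈) (s≤s le) = Mem.∈-concatMap⁺ _ (Any.map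
  (λ { refl → Mem.∈-map⁺ (V ∪_) (∈-unions {m = m} ⊥∈ Vs Vs∈ le) }) V∈)

∈-⋃⁺ : ∀ {n x} {Vs : List (Subset n)} → Any (x ∈_) Vs → x ∈ ⋃ Vs
∈-⋃⁺ (here x∈)  = ∪ˡ x∈
∈-⋃⁺ (there x∈) = ∪ʳ (∈-⋃⁺ x∈)

∈-⋃⁻ : ∀ {n x} (Vs : List (Subset n)) → x ∈ ⋃ Vs → Any (x ∈_) Vs
∈-⋃⁻ [] x∈ = contradiction x∈ ∉⊥
∈-⋃⁻ (V ∷ Vs) x∈ = ∪-elim here (there ∘ ∈-⋃⁻ Vs) x∈

∣⁅x⁆∪p∣ : ∀ {n} (x : Fin n) p → x ∉ p → ∣ ⁅ x ⁆ ∪ p ∣ ≡ suc ∣ p ∣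
∣⁅x⁆∪p∣ zero    (inside Vec.∷ p)  x∉ = contradiction Vec.here x∉
∣⁅x⁆∪p∣ zero    (outside Vec.∷ p) x∉ = cong (suc ∘ ∣_∣) (∪-identityˡ p)
∣⁅x⁆∪p∣ (suc x) (inside Vec.∷ p)  x∉ = cong suc (∣⁅x⁆∪p∣ x p (x∉ ∘ Vec.there))
∣⁅x⁆∪p∣ (suc x) (outside Vec.∷ p) x∉ = ∣⁅x⁆∪p∣ x p (x∉ ∘ Vec.there)

-- Sequences, ladder vertices and the numerical bounds.

_◂_ : ∀ {A : Set} → A → (ℕ → A) → ℕ → A
(x ◂ f) zero    = x
(x ◂ f) (suc i) = f i

_≟ᴸ_ : ∀ {k} → DecidableEquality (LadderVertex k)
ℓ i ≟ᴸ ℓ j = map′ (cong ℓ) (λ { refl → refl }) (i ≟ j)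
ℓ i ≟ᴸ s j = no λ ()
ℓ i ≟ᴸ r j = no λ ()
s i ≟ᴸ ℓ j = no λ ()
s i ≟ᴸ s j = map′ (cong s) (λ { refl → refl }) (i ≟ j)
s i ≟ᴸ r j = no λ ()
r i ≟ᴸ ℓ j = no λ ()
r i ≟ᴸ s j = no λ ()
r i ≟ᴸ r j = map′ (cong r) (λ { refl → refl }) (i ≟ j)

-- The size that lets `path-or-crossing` find `a` increasing or `b` decreasing parts. One step
-- spends `2 + g + f` on what is attached to the grown set and `k` on what is attached to its
-- boundary; each of the `k` branches must then be able to keep enough for either recursive call.
sizeThreshold : ℕ → ℕ → ℕ → ℕ → ℕ → ℕ
sizeThreshold k g f zero    b       = 0
sizeThreshold k g f (suc a) zero    = 0
sizeThreshold k g f (suc a) (suc b) = suc (suc (g + f)) + (k + k * (sizeThreshold k g f a (suc b) + sizeThreshold k g f (suc a) b))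

-- One index is used up by the step, one makes the pigeonhole inequality strict. The sum under the
-- factor `k` ensures that the larger or the smaller tags are numerous enough.
indexThreshold : ℕ → ℕ → ℕ → ℕ
indexThreshold k zero    b       = 0
indexThreshold k (suc a) zero    = 0
indexThreshold k (suc a) (suc b) = 2 + k * (indexThreshold k a (suc b) + indexThreshold k (suc a) b)

-- In the recursive case the search in one side must yield `q` parts, each large enough (`f`) for
-- the search in the other side to select `k` of them; a crossing in either search must exceed the
-- bound `g` for `d`.
dominationBound : ℕ → ℕ → ℕ
dominationBound k zero    = 2 + k
dominationBound k (suc d) =
  let q = indexThreshold k k k ; g = dominationBound k d in sizeThreshold k g (sizeThreshold k g k k k) q q

-- Each dominator is replaced by one vertex outside the set and a cover for the next smaller clique
-- number.
coverBound : ℕ → ℕ → ℕ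
coverBound k zero    = 0
coverBound k (suc j) = dominationBound k k * suc (coverBound k j)

-- Adjacency, connectedness and growth of vertex sets.

module _ {n : ℕ} (G : Graph (Fin n)) where
  open Graph G

  infix 4 _adj_
  _adj_ : Fin n → Subset n → Set
  _adj_ = HasNeighborIn G

  adj? : ∀ t X → Dec (t adj X)
  adj? t X = any? λ u → u ∈? X ×-dec t ~? u

  adj-mono : ∀ {X Y t} → X ⊆ Y → t adj X → t adj Y
  adj-mono X⊆Y (u , u∈X , t~u) = u , X⊆Y u∈X , t~u

  adj-∪ : ∀ {X Y t} → t adj X ∪ Y → t adj X ⊎ t adj Y
  adj-∪ (u , u∈ , t~u) = ∪-elim (λ u∈X → inj₁ (u , u∈X , t~u)) (λ u∈Y → inj₂ (u , u∈Y , t~u)) u∈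

  adj⁅⁆⁻ : ∀ {t u} → t adj ⁅ u ⁆ → t ~ u
  adj⁅⁆⁻ {t} (v , v∈ , t~v) = subst (t ~_) (∈⁅⁆⁻ v∈) t~v

  adj⁅⁆⁺ : ∀ {t u} → t ~ u → t adj ⁅ u ⁆
  adj⁅⁆⁺ {u = u} t~u = u , x∈⁅x⁆ u , t~u

  nb : Subset n → Subset n
  nb X = ⟪ (λ t → adj? t X) ⟫

  ∈nb⁺ : ∀ {X t} → t adj X → t ∈ nb X
  ∈nb⁺ {X} = ∈⟪⟫⁺ (λ t → adj? t X)

  ∈nb⁻ : ∀ {X t} → t ∈ nb X → t adj X
  ∈nb⁻ {X} = ∈⟪⟫⁻ (λ t → adj? t X)

  Apart : Subset n → Subset n → Set
  Apart X Y = ∀ {u v} → u ∈ X → v ∈ Y → u ≢ v × ¬ (u ~ v)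

  apart-sym : ∀ {X Y} → Apart X Y → Apart Y X
  apart-sym ap u∈Y v∈X = let u≢v , u≁v = ap v∈X u∈Y in u≢v ∘ sym , u≁v ∘ ~-sym

  apart-mono : ∀ {X Y X′ Y′} → X′ ⊆ X → Y′ ⊆ Y → Apart X Y → Apart X′ Y′
  apart-mono f g ap u∈ v∈ = ap (f u∈) (g v∈)

  apart-∪ˡ : ∀ {X Y Z} → Apart X Z → Apart Y Z → Apart (X ∪ Y) Z
  apart-∪ˡ p q u∈ v∈ = ∪-elim (λ u∈ → p u∈ v∈) (λ u∈ → q u∈ v∈) u∈

  apart⇒¬adj : ∀ {X Y u} → Apart X Y → u ∈ X → ¬ u adj Y
  apart⇒¬adj ap u∈X (v , v∈Y , u~v) = proj₂ (ap u∈X v∈Y) u~v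

  apart-⁅⁆ : ∀ {X u} → u ∉ X → ¬ u adj X → Apart ⁅ u ⁆ X
  apart-⁅⁆ {X} {u} u∉X u≁X {w} {v} w∈ v∈ with ∈⁅⁆⁻ w∈
  ... | refl = (λ { refl → u∉X v∈ }) , λ u~v → u≁X (v , v∈ , u~v)

  -- Overlap counts as touching: sides of different separators that share a vertex occur as `A` and
  -- `D i` in a `Broom`.
  Touch : Subset n → Subset n → Set
  Touch X Y = ∃₂ λ u v → u ∈ X × v ∈ Y × (u ≡ v ⊎ u ~ v)

  touch-sym : ∀ {X Y} → Touch X Y → Touch Y X
  touch-sym (u , v , u∈ , v∈ , inj₁ e) = v , u , v∈ , u∈ , inj₁ (sym e)
  touch-sym (u , v , u∈ , v∈ , inj₂ e) = v , u , v∈ , u∈ , inj₂ (~-sym e)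

  touch-mono : ∀ {X Y X′ Y′} → X ⊆ X′ → Y ⊆ Y′ → Touch X Y → Touch X′ Y′
  touch-mono f g (u , v , u∈ , v∈ , e) = u , v , f u∈ , g v∈ , e

  path-mono : ∀ {X Y u v} → X ⊆ Y → Star (InducedAdj G X) u v → Star (InducedAdj G Y) u v
  path-mono X⊆Y = Star.map λ (u∈ , v∈ , u~v) → X⊆Y u∈ , X⊆Y v∈ , u~v

  path-sym : ∀ {X u v} → Star (InducedAdj G X) u v → Star (InducedAdj G X) v u
  path-sym = Star.reverse λ (u∈ , v∈ , u~v) → v∈ , u∈ , ~-sym u~v

  connected-from : ∀ {X c} → c ∈ X → (∀ {w} → w ∈ X → Star (InducedAdj G X) c w) → Connected G X
  connected-from {c = c} c∈X f = (c , c∈X) , λ u∈ v∈ → path-sym (f u∈) ◅◅ f v∈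

  connected-⁅⁆ : ∀ v → Connected G ⁅ v ⁆
  connected-⁅⁆ v = connected-from (x∈⁅x⁆ v) λ w∈ → subst (Star _ v) (sym (∈⁅⁆⁻ w∈)) ε

  connected-∪ : ∀ {X Y} → Connected G X → Connected G Y → Touch X Y → Connected G (X ∪ Y)
  connected-∪ {X} {Y} (_ , cX) (_ , cY) (u , v , u∈X , v∈Y , uv) =
    connected-from (∪ˡ u∈X) λ w∈ → ∪-elim
      (λ w∈X → path-mono ∪ˡ (cX u∈X w∈X))
      (λ w∈Y → step uv ◅◅ path-mono ∪ʳ (cY v∈Y w∈Y)) w∈
    where
    step : u ≡ v ⊎ u ~ v → Star (InducedAdj G (X ∪ Y)) u v
    step (inj₁ refl) = ε
    step (inj₂ u~v)  = (∪ˡ u∈X , ∪ʳ v∈Y , u~v) ◅ ε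

  connected-∪⁅⁆ : ∀ {X u} → Connected G X → u adj X → Connected G (X ∪ ⁅ u ⁆)
  connected-∪⁅⁆ {u = u} cX (v , v∈X , u~v) =
    connected-∪ cX (connected-⁅⁆ u) (v , u , v∈X , x∈⁅x⁆ u , inj₂ (~-sym u~v))

  exit : ∀ {X C a b} → Connected G X → a ∈ X → a ∈ C → b ∈ X → b ∉ C →
         ∃ λ x → x ∈ X × x ∉ C × x adj C
  exit {X} {C} (_ , cX) a∈X a∈C b∈X b∉C = walk (cX a∈X b∈X) a∈C
    where
    walk : ∀ {a} → Star (InducedAdj G X) a _ → a ∈ C → ∃ λ x → x ∈ X × x ∉ C × x adj C
    walk ε a∈C = contradiction a∈C b∉C
    walk {a} (_◅_ {j = x} (_ , x∈X , a~x) rest) a∈C with x ∈? C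
    ... | yes x∈C = walk rest x∈C
    ... | no x∉C  = x , x∈X , x∉C , a , a∈C , ~-sym a~x

  record Grown (X : Subset n) (P : Pred (Subset n) 0ℓ) (C₀ : Subset n) : Set where
    field
      C         : Subset n
      C₀⊆C      : C₀ ⊆ C
      C⊆X       : C ⊆ X
      connected : Connected G C
      holds     : P C
      maximal   : ∀ {u} → u ∈ X → u ∉ C → u adj C → ¬ P (C ∪ ⁅ u ⁆)

  -- Greedy enlargement by one adjacent vertex at a time; strict inclusion of finite sets is
  -- well-founded.
  grow : ∀ X {P : Pred (Subset n) 0ℓ} → Decidable P → ∀ {C₀} → C₀ ⊆ X → Connected G C₀ → P C₀ → Grown X P C₀
  grow X {P} P? {C₀} C₀⊆X cC₀ pC₀ = go C₀ (⊃-wellFounded C₀) id C₀⊆X cC₀ pC₀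
    where
    go : ∀ C → Acc _⊃_ C → C₀ ⊆ C → C ⊆ X → Connected G C → P C → Grown X P C₀
    go C (acc rs) C₀⊆C C⊆X cC pC
      with any? (λ u → u ∈? X ×-dec (¬? (u ∈? C) ×-dec (adj? u C ×-dec P? (C ∪ ⁅ u ⁆))))
    ... | yes (u , u∈X , u∉C , u~C , p) =
      go (C ∪ ⁅ u ⁆) (rs (∪ˡ , u , ∪ʳ (x∈⁅x⁆ u) , u∉C)) (∪ˡ ∘ C₀⊆C) (∪-lub C⊆X (⁅⁆⊆ u∈X))
         (connected-∪⁅⁆ cC u~C) p
    ... | no none = record
      { C = C ; C₀⊆C = C₀⊆C ; C⊆X = C⊆X ; connected = cC ; holds = pC
      ; maximal = λ u∈X u∉C u~C p → none (_ , u∈X , u∉C , u~C , p) }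

  record Pushed (X Q₀ : Subset n) (P : Pred (Fin n) 0ℓ) : Set where
    field
      Q         : Subset n
      x         : Fin n
      Q₀⊆Q      : Q₀ ⊆ Q
      Q⊆X       : Q ⊆ X
      connected : Connected G Q
      ¬P        : ∀ {v} → v ∈ Q → ¬ P v
      x∈X       : x ∈ X
      x~Q       : x adj Q
      Px        : P x

  -- `Q` is a maximal connected set avoiding `P`. As `X` is connected and contains `u`, some vertex
  -- of `X` outside `Q` is adjacent to `Q`, and by maximality it satisfies `P`.
  push : ∀ {X Q₀} {P : Pred (Fin n) 0ℓ} → Decidable P → Connected G X → Connected G Q₀ → Q₀ ⊆ X →
         (∀ {v} → v ∈ Q₀ → ¬ P v) → ∀ {u} → u ∈ X → P u → Pushed X Q₀ P
  push {X} {Q₀} {P} P? cX cQ₀ Q₀⊆X ¬P₀ {u} u∈X Pu = result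
    where
    Free : Pred (Subset n) 0ℓ
    Free Q = ¬ (∃ λ v → v ∈ Q × P v)
    open Grown (grow X {Free} (λ Q → ¬? (any? λ v → v ∈? Q ×-dec P? v)) Q₀⊆X cQ₀ (λ (v , v∈ , pv) → ¬P₀ v∈ pv))
    q∈ : proj₁ (proj₁ cQ₀) ∈ C
    q∈ = C₀⊆C (proj₂ (proj₁ cQ₀))
    result : Pushed X Q₀ P
    result with exit cX (C⊆X q∈) q∈ u∈X (λ u∈C → holds (u , u∈C , Pu))
    ... | x , x∈X , x∉C , x~C = record
      { Q = C ; x = x ; Q₀⊆Q = C₀⊆C ; Q⊆X = C⊆X ; connected = connected
      ; ¬P = λ v∈ pv → holds (_ , v∈ , pv) ; x∈X = x∈X ; x~Q = x~C
      ; Px = decidable-stable (P? x) λ ¬px → maximal x∈X x∉C x~C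
               λ (v , v∈ , pv) → ∪-elim (λ v∈C → holds (v , v∈C , pv)) (λ v∈x → ¬px (subst P (∈⁅⁆⁻ v∈x) pv)) v∈ }

  -- Creatures

  -- A looser form of a creature: the sets `D i` may overlap one another and `A`; only the
  -- adjacencies of the `z i` tell them apart.
  record Broom (k : ℕ) : Set where
    field
      A B     : Subset n
      D       : Fin k → Subset n
      z       : Fin k → Fin n
      conn-A  : Connected G A
      conn-B  : Connected G B
      conn-D  : ∀ i → Connected G (D i)
      touch   : ∀ i → Touch A (D i)
      A-apart : Apart A B
      D-apart : ∀ i → Apart (D i) B
      z~D     : ∀ i → z i adj D i
      z≁D     : ∀ {i j} → i ≢ j → ¬ z i adj D j
      z≁A     : ∀ i → ¬ z i adj A
      z~B     : ∀ i → z i adj B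

  -- A is enlarged into each D i, up to the first neighbour x i of z i.
  broom⇒creature : ∀ {k} → Broom k → Creature G k
  broom⇒creature {k} broom = record
    { A = A′ ; B = B ; x = x ; y = z
    ; x-injective = λ {i} {j} xi≡xj → decidable-stable (i ≟ j) λ i≢j →
        z≁D (i≢j ∘ sym) (x i , x∈D i , subst (z j ~_) (sym xi≡xj) (z~x j))
    ; y-injective = λ {i} {j} zi≡zj → decidable-stable (i ≟ j) λ i≢j →
        z≁D (i≢j ∘ sym) (subst (_adj D i) zi≡zj (z~D i))
    ; A∩B=∅ = λ (v , v∈) → let v∈A′ , v∈B = ∩⁻ v∈ in proj₁ (A′-apart v∈A′ v∈B) refl
    ; x∉A = λ i xi∈A′ → z≁A′ i (x i , xi∈A′ , z~x i)
    ; x∉B = λ i xi∈B → proj₁ (D-apart i (x∈D i) xi∈B) refl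
    ; y∉A = λ i zi∈A′ → let b , b∈B , zi~b = z~B i in proj₂ (A′-apart zi∈A′ b∈B) zi~b
    ; y∉B = z∉B
    ; x≢y = λ i j xi≡zj → let b , b∈B , zj~b = z~B j in
        proj₂ (D-apart i (x∈D i) b∈B) (subst (_~ b) (sym xi≡zj) zj~b)
    ; A-connected = conn-A′
    ; B-connected = conn-B
    ; antiComplete = λ u∈ v∈ → proj₂ (A′-apart u∈ v∈)
    ; x~y = λ i → ~-sym (z~x i)
    ; x-nbr-A = λ i → adj-mono (Q⊆A′ i) (P.x~Q i)
    ; x-non-B = λ i → apart⇒¬adj (D-apart i) (x∈D i)
    ; y-nbr-B = z~B
    ; y-non-A = z≁A′
    ; x≁y = λ {i} {j} i≢j xi~zj → z≁D (i≢j ∘ sym) (x i , x∈D i , ~-sym xi~zj)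
    }
    where
    open Broom broom
    pushed : ∀ i → Pushed (A ∪ D i) A (z i ~_)
    pushed i = let u , u∈D , z~u = z~D i in
      push (z i ~?_) (connected-∪ conn-A (conn-D i) (touch i)) conn-A ∪ˡ
        (λ v∈A z~v → z≁A i (_ , v∈A , z~v)) (∪ʳ u∈D) z~u
    module P i = Pushed (pushed i)
    x : Fin k → Fin n
    x = P.x
    z~x : ∀ i → z i ~ x i
    z~x = P.Px
    x∈D : ∀ i → x i ∈ D i
    x∈D i = ∪-elim (λ x∈A → contradiction (x i , x∈A , z~x i) (z≁A i)) id (P.x∈X i)
    A′? : Decidable (λ v → v ∈ A ⊎ ∃ λ i → v ∈ P.Q i)
    A′? v = v ∈? A ⊎-dec any? λ i → v ∈? P.Q i
    A′ : Subset n
    A′ = ⟪ A′? ⟫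
    A⊆A′ : A ⊆ A′
    A⊆A′ = ∈⟪⟫⁺ A′? ∘ inj₁
    Q⊆A′ : ∀ i → P.Q i ⊆ A′
    Q⊆A′ i v∈ = ∈⟪⟫⁺ A′? (inj₂ (i , v∈))
    A′-apart : Apart A′ B
    A′-apart u∈ v∈B with ∈⟪⟫⁻ A′? u∈
    ... | inj₁ u∈A       = A-apart u∈A v∈B
    ... | inj₂ (i , u∈Q) = ∪-elim (λ u∈A → A-apart u∈A v∈B) (λ u∈D → D-apart i u∈D v∈B) (P.Q⊆X i u∈Q)
    z≁A′ : ∀ i → ¬ z i adj A′
    z≁A′ i (u , u∈ , z~u) with ∈⟪⟫⁻ A′? u∈
    ... | inj₁ u∈A       = z≁A i (u , u∈A , z~u)
    ... | inj₂ (j , u∈Q) with i ≟ j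
    ...   | yes refl = P.¬P i u∈Q z~u
    ...   | no i≢j   = ∪-elim (λ u∈A → z≁A i (u , u∈A , z~u)) (λ u∈D → z≁D i≢j (u , u∈D , z~u)) (P.Q⊆X j u∈Q)
    z∉B : ∀ i → z i ∉ B
    z∉B i zi∈B = let u , u∈D , z~u = z~D i in proj₂ (D-apart i u∈D zi∈B) (~-sym z~u)
    a∈A : proj₁ (proj₁ conn-A) ∈ A
    a∈A = proj₂ (proj₁ conn-A)
    conn-A′ : Connected G A′
    conn-A′ = connected-from (A⊆A′ a∈A) λ w∈ → case ∈⟪⟫⁻ A′? w∈ of λ where
      (inj₁ w∈A)       → path-mono A⊆A′ (proj₂ conn-A a∈A w∈A)
      (inj₂ (i , w∈Q)) → path-mono (Q⊆A′ i) (proj₂ (P.connected i) (P.Q₀⊆Q i a∈A) w∈Q)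

  Private : Subset n × Fin n → Subset n × Fin n → Set
  Private (D , t) (D′ , t′) = ¬ t adj D′ × ¬ t′ adj D

  Covers : List (Subset n) → Subset n → Set
  Covers 𝒟 T = ∀ {t} → t ∈ T → Any (t adj_) 𝒟

  -- A set is kept only if some `t` is missed by the sets kept before and by those still to come;
  -- this `t` becomes its private vertex. The other sets are dropped without losing coverage.
  irredundant : (𝒟 : List (Subset n)) (T : Subset n) → Covers 𝒟 T →
    ∃ λ ps → All (λ p → proj₁ p ∈ˡ 𝒟 × proj₂ p ∈ T × proj₂ p adj proj₁ p) ps × AllPairs Private ps ×
             Covers (map proj₁ ps) T
  irredundant 𝒟 T cov = go 𝒟 id [] [] [] [] (inj₂ ∘ cov)
    where
    Good : Pred (Subset n × Fin n) 0ℓ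
    Good p = proj₁ p ∈ˡ 𝒟 × proj₂ p ∈ T × proj₂ p adj proj₁ p
    go : ∀ todo → (∀ {D} → D ∈ˡ todo → D ∈ˡ 𝒟) → ∀ ps → All Good ps → AllPairs Private ps →
         All (λ p → All (λ D → ¬ proj₂ p adj D) todo) ps →
         (∀ {t} → t ∈ T → Any (t adj_) (map proj₁ ps) ⊎ Any (t adj_) todo) →
         ∃ λ ps → All Good ps × AllPairs Private ps × Covers (map proj₁ ps) T
    go [] _ ps good priv free cov = ps , good , priv , λ t∈ → [ id , (λ ()) ]′ (cov t∈)
    go (D ∷ todo) sub ps good priv free cov
      with any? (λ t → t ∈? T ×-dec (¬? (Any.any? (λ D → adj? t D) (map proj₁ ps))
                                     ×-dec ¬? (Any.any? (λ D → adj? t D) todo)))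
    ... | no none = go todo (sub ∘ there) ps good priv (All.map All.tail free) cov′
      where
      cov′ : ∀ {t} → t ∈ T → Any (t adj_) (map proj₁ ps) ⊎ Any (t adj_) todo
      cov′ {t} t∈ with Any.any? (λ D → adj? t D) (map proj₁ ps) | Any.any? (λ D → adj? t D) todo
      ... | yes p | _     = inj₁ p
      ... | no _  | yes q = inj₂ q
      ... | no ¬p | no ¬q = contradiction (t , t∈ , ¬p , ¬q) none
    ... | yes (t , t∈T , ¬ps , ¬todo) =
      go todo (sub ∘ there) ((D , t) ∷ ps) ((sub (here refl) , t∈T , t~D) ∷ good)
         (All.zipWith (λ (a , b) → a , All.head b) (All.map⁻ (All.¬Any⇒All¬ _ ¬ps) , free) ∷ priv)
         (All.¬Any⇒All¬ _ ¬todo ∷ All.map All.tail free)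
         λ t∈ → case cov t∈ of λ where
           (inj₁ p)         → inj₁ (there p)
           (inj₂ (here p))  → inj₁ (here p)
           (inj₂ (there q)) → inj₂ q
      where
      t~D : t adj D
      t~D = case cov t∈T of λ where
        (inj₁ p)         → contradiction p ¬ps
        (inj₂ (here p))  → p
        (inj₂ (there q)) → contradiction q ¬todo

  -- The private vertices of an irredundant subcover are the `z i` of a broom with handle `A`, so a
  -- subcover with more than `k` sets gives a `k`-creature.
  cover : ∀ {k} → CreatureFree G k → ∀ {A B} → Connected G A → Connected G B → Apart A B →
    (𝒟 : List (Subset n)) → (∀ {D} → D ∈ˡ 𝒟 → Connected G D × Touch A D × Apart D B) →
    (T : Subset n) → (∀ {t} → t ∈ T → t adj B × ¬ t adj A) → Covers 𝒟 T →
    ∃ λ 𝒟′ → length 𝒟′ ≤ k × All (_∈ˡ 𝒟) 𝒟′ × Covers 𝒟′ T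
  cover {k} free {A} {B} conn-A conn-B A-apart 𝒟 𝒟-good T T-good cov
    with irredundant 𝒟 T cov
  ... | ps , good , priv , cov′ with length ps ℕ.≤? k
  ...   | yes ≤k = map proj₁ ps , subst (_≤ k) (sym (List.length-map proj₁ ps)) ≤k
                 , All.map⁺ (All.map proj₁ good) , cov′
  ...   | no ≰k = contradiction (broom⇒creature broom) free
    where
    at : Fin k → Fin (length ps)
    at i = Fin.inject≤ i (ℕ.<⇒≤ (ℕ.≰⇒> ≰k))
    p : Fin k → Subset n × Fin n
    p i = List.lookup ps (at i)
    good′ : ∀ i → proj₁ (p i) ∈ˡ 𝒟 × proj₂ (p i) ∈ T × proj₂ (p i) adj proj₁ (p i)
    good′ i = All.lookup good (Mem.∈-lookup (at i))
    broom : Broom k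
    broom = record
      { A = A ; B = B ; D = proj₁ ∘ p ; z = proj₂ ∘ p ; conn-A = conn-A ; conn-B = conn-B
      ; conn-D = λ i → proj₁ (𝒟-good (proj₁ (good′ i)))
      ; touch = λ i → proj₁ (proj₂ (𝒟-good (proj₁ (good′ i))))
      ; A-apart = A-apart
      ; D-apart = λ i → proj₂ (proj₂ (𝒟-good (proj₁ (good′ i))))
      ; z~D = λ i → proj₂ (proj₂ (good′ i))
      ; z≁D = λ i≢j → proj₁ (lookup-pairs {R = Private} swap priv (i≢j ∘ Fin.inject≤-injective _ _ _ _))
      ; z≁A = λ i → proj₂ (T-good (proj₁ (proj₂ (good′ i))))
      ; z~B = λ i → proj₁ (T-good (proj₁ (proj₂ (good′ i)))) }

  -- Domination

  ball : Fin n → Subset n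
  ball v = ⁅ v ⁆ ∪ nb ⁅ v ⁆

  ∈ball⁻ : ∀ {t v} → t ∈ ball v → t ≡ v ⊎ t ~ v
  ∈ball⁻ t∈ = ∪-elim (inj₁ ∘ ∈⁅⁆⁻) (inj₂ ∘ adj⁅⁆⁻ ∘ ∈nb⁻) t∈

  ∈ball-≡ : ∀ {v} → v ∈ ball v
  ∈ball-≡ = ∪ˡ (x∈⁅x⁆ _)

  ∈ball-~ : ∀ {t v} → t ~ v → t ∈ ball v
  ∈ball-~ t~v = ∪ʳ (∈nb⁺ (adj⁅⁆⁺ t~v))

  -- Domination of T by m vertices of Y, phrased recursively so that it is decidable.
  Dom : Subset n → ℕ → Subset n → Set
  Dom Y zero    T = Empty T
  Dom Y (suc m) T = Empty T ⊎ ∃ λ v → v ∈ Y × Dom Y m (T ∖ ball v)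

  empty? : ∀ (T : Subset n) → Dec (Empty T)
  empty? T = ¬? (nonempty? T)

  dom? : ∀ Y m T → Dec (Dom Y m T)
  dom? Y zero    T = empty? T
  dom? Y (suc m) T = empty? T ⊎-dec any? λ v → v ∈? Y ×-dec dom? Y m (T ∖ ball v)

  dom-empty : ∀ {Y m T} → Empty T → Dom Y m T
  dom-empty {m = zero}  e = e
  dom-empty {m = suc m} e = inj₁ e

  dom-mono : ∀ {Y m m′ T T′} → m ≤ m′ → T′ ⊆ T → Dom Y m T → Dom Y m′ T′
  dom-mono {m = zero} _ sub e = dom-empty λ (v , v∈) → e (v , sub v∈)
  dom-mono {m = suc m} (s≤s _) sub (inj₁ e) = inj₁ λ (v , v∈) → e (v , sub v∈)
  dom-mono {m = suc m} (s≤s le) sub (inj₂ (v , v∈Y , d)) =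
    inj₂ (v , v∈Y , dom-mono le (λ x∈ → let x∈T , x∉ = ∖⁻ x∈ in ∖⁺ (sub x∈T) x∉) d)

  dom-∪ : ∀ {Y a b S T U} → Dom Y a S → Dom Y b T → U ⊆ S ∪ T → Dom Y (a + b) U
  dom-∪ {a = zero} e d sub =
    dom-mono ℕ.≤-refl (λ x∈ → ∪-elim (λ x∈S → contradiction (_ , x∈S) e) id (sub x∈)) d
  dom-∪ {a = suc a} {b} (inj₁ e) d sub =
    dom-mono (ℕ.m≤n+m b (suc a)) (λ x∈ → ∪-elim (λ x∈S → contradiction (_ , x∈S) e) id (sub x∈)) d
  dom-∪ {a = suc a} {S = S} {T} {U} (inj₂ (v , v∈Y , d)) d′ sub = inj₂ (v , v∈Y , dom-∪ d d′ sub′)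
    where
    sub′ : U ∖ ball v ⊆ (S ∖ ball v) ∪ T
    sub′ x∈ = let x∈U , x∉ = ∖⁻ x∈ in ∪-elim (λ x∈S → ∪ˡ (∖⁺ x∈S x∉)) ∪ʳ (sub x∈U)

  dom-ball : ∀ {Y v T} → v ∈ Y → T ⊆ ball v → Dom Y 1 T
  dom-ball v∈Y sub = inj₂ (_ , v∈Y , λ (x , x∈) → let x∈T , x∉ = ∖⁻ x∈ in x∉ (sub x∈T))

  dom-balls : ∀ {Y T} (vs : List (Fin n)) → All (_∈ Y) vs → (∀ {t} → t ∈ T → Any (λ v → t ∈ ball v) vs) →
              Dom Y (length vs) T
  dom-balls [] [] cov (t , t∈) = case cov t∈ of λ ()
  dom-balls (v ∷ vs) (v∈Y ∷ vs∈Y) cov = inj₂ (v , v∈Y , dom-balls vs vs∈Y λ t∈ →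
    let t∈T , t∉ = ∖⁻ t∈ in case cov t∈T of λ where
      (here t∈ball) → contradiction t∈ball t∉
      (there p)     → p)

  dom-covers : ∀ {Y m T} (𝒟 : List (Subset n)) → All (λ D → Dom Y m (T ∩ nb D)) 𝒟 → Covers 𝒟 T →
               Dom Y (length 𝒟 * m) T
  dom-covers [] [] cov (t , t∈) = case cov t∈ of λ ()
  dom-covers {T = T} (D ∷ 𝒟) (d ∷ ds) cov =
    dom-∪ {S = T ∩ nb D} {T = T ∖ nb D} d (dom-covers 𝒟 (All.map (dom-mono ℕ.≤-refl sub) ds) cov′) split
    where
    sub : ∀ {X} → (T ∖ nb D) ∩ X ⊆ T ∩ X
    sub x∈ = let x∈T , x∈X = ∩⁻ x∈ in ∩⁺ (proj₁ (∖⁻ x∈T)) x∈X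
    cov′ : Covers 𝒟 (T ∖ nb D)
    cov′ t∈ = let t∈T , t∉ = ∖⁻ t∈ in case cov t∈T of λ where
      (here p)  → contradiction (∈nb⁺ p) t∉
      (there p) → p
    split : T ⊆ (T ∩ nb D) ∪ (T ∖ nb D)
    split {x} x∈ with x ∈? nb D
    ... | yes p = ∪ˡ (∩⁺ x∈ p)
    ... | no ¬p = ∪ʳ (∖⁺ x∈ ¬p)

  ¬dom⇒nonempty : ∀ {Y m T} → ¬ Dom Y m T → Nonempty T
  ¬dom⇒nonempty {T = T} nd = decidable-stable (nonempty? T) (nd ∘ dom-empty)

  -- Finite choice, with the chosen sets gathered in a list.
  collect : ∀ {X : Subset n} {Q : Fin n → Subset n → Set} → (∀ {u} → u ∈ X → ∃ (Q u)) → ∀ us →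
            ∃ λ 𝒟 → All (λ D → ∃ λ u → u ∈ X × Q u D) 𝒟 × (∀ {u} → u ∈ˡ us → u ∈ X → Any (Q u) 𝒟)
  collect f [] = [] , [] , λ ()
  collect {X} f (u ∷ us) with collect f us | u ∈? X
  ... | 𝒟 , all , any | yes u∈X = let D , q = f u∈X in
    D ∷ 𝒟 , (u , u∈X , q) ∷ all , λ { (here refl) _ → here q ; (there p) v∈X → there (any p v∈X) }
  ... | 𝒟 , all , any | no u∉X =
    𝒟 , all , λ { (here refl) u∈X → contradiction u∈X u∉X ; (there p) → any p }

  -- `cover` is applied to the singletons of `U`; what is attached to a singleton lies in one ball.
  cover-by-vertices : ∀ {k} → CreatureFree G k → ∀ {Y A B U T} → Connected G A → Connected G B →
    Apart A B → Apart U B → U ⊆ Y → (∀ {u} → u ∈ U → u adj A) →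
    (∀ {t} → t ∈ T → t adj B × ¬ t adj A) → T ⊆ nb U → Dom Y k T
  cover-by-vertices {k} free {Y} {A} {B} {U} {T} conn-A conn-B A-apart U-apart U⊆Y U~A T-good T⊆nbU
    with collect {U} {λ u D → D ≡ ⁅ u ⁆} (λ _ → _ , refl) (List.allFin n)
  ... | 𝒟 , all , any
    with cover free conn-A conn-B A-apart 𝒟 good T T-good cov
    where
    good : ∀ {D} → D ∈ˡ 𝒟 → Connected G D × Touch A D × Apart D B
    good D∈ with All.lookup all D∈
    ... | u , u∈U , refl = connected-⁅⁆ u
      , (let a , a∈A , u~a = U~A u∈U in a , u , a∈A , x∈⁅x⁆ u , inj₂ (~-sym u~a))
      , apart-mono (⁅⁆⊆ u∈U) id U-apart
    cov : Covers 𝒟 T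
    cov {t} t∈ = let u , u∈U , t~u = ∈nb⁻ (T⊆nbU t∈) in
      Any.map (λ { refl → adj⁅⁆⁺ t~u }) (any (Mem.∈-allFin u) u∈U)
  ... | 𝒟′ , ≤k , 𝒟′⊆𝒟 , cov′ = dom-mono (ℕ.≤-trans (ℕ.≤-reflexive (ℕ.*-identityʳ _)) ≤k) id
    (dom-covers 𝒟′ (All.map small 𝒟′⊆𝒟) cov′)
    where
    small : ∀ {D} → D ∈ˡ 𝒟 → Dom Y 1 (T ∩ nb D)
    small D∈ with All.lookup all D∈
    ... | u , u∈U , refl = dom-ball (U⊆Y u∈U) (∪ʳ ∘ proj₂ ∘ ∩⁻)

  connected-∪-nbrs : ∀ {X Z} → Connected G X → (∀ {z} → z ∈ Z → z adj X) → Connected G (X ∪ Z)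
  connected-∪-nbrs {X} {Z} ((c , c∈X) , conn) Z~X = connected-from (∪ˡ c∈X) λ w∈ → ∪-elim
    (λ w∈X → path-mono ∪ˡ (conn c∈X w∈X))
    (λ w∈Z → let u , u∈X , w~u = Z~X w∈Z in
      path-mono ∪ˡ (conn c∈X u∈X) ◅◅ ((∪ˡ u∈X , ∪ʳ w∈Z , ~-sym w~u) ◅ ε)) w∈

  record Growth (Y L : Subset n) (v : Fin n) (f : ℕ) (T : ℕ → Subset n) (js : List ℕ) : Set where
    field
      C       : Subset n
      v∈C     : v ∈ C
      C⊆L     : C ⊆ L
      conn-C  : Connected G C
      j       : ℕ
      j∈js    : j ∈ˡ js
      large   : ¬ Dom Y f (T j ∩ nb C)
      bounded : ∀ {i} → i ∈ˡ js → Dom Y (suc f) (T i ∩ nb C)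

  -- `C` grows from `v` while the attached part of every `T i` stays within the threshold. The next
  -- vertex `x` makes some `T j` exceed it, but adds only its own ball, so every part stays within
  -- the threshold plus one.
  growth : ∀ {Y L v f T js} → Connected G L → v ∈ L → L ⊆ Y →
           (∃ λ j → j ∈ˡ js × ¬ Dom Y (suc f) (T j ∩ nb L)) → Growth Y L v (suc f) T js
  growth {Y} {L} {v} {f} {T} {js} conn-L v∈L L⊆Y (j , j∈js , j-large) = result
    where
    Small : Pred (Subset n) 0ℓ
    Small C = All (λ i → Dom Y (suc f) (T i ∩ nb C)) js
    small? : Decidable Small
    small? C = All.all? (λ i → dom? Y (suc f) (T i ∩ nb C)) js
    -- At the start only neighbours of `v` are attached, dominated by `v` itself; this requires a
    -- positive threshold.
    open Grown (grow L small? (⁅⁆⊆ v∈L) (connected-⁅⁆ v)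
      (All.tabulate λ _ → dom-mono (s≤s z≤n) id (dom-ball (L⊆Y v∈L) (∪ʳ ∘ proj₂ ∘ ∩⁻))))
    -- `L` itself is attached to too much of `T j`, so `C` is a proper subset.
    outside-C : ∃ λ b → b ∈ L × b ∉ C
    outside-C = decidable-stable (any? λ b → b ∈? L ×-dec ¬? (b ∈? C)) λ none →
      j-large (dom-mono ℕ.≤-refl (λ t∈ → let t∈T , t∈nb = ∩⁻ t∈ in ∩⁺ t∈T (∈nb⁺ (adj-mono
        (λ {u} u∈L → decidable-stable (u ∈? C) λ u∉C → none (u , u∈L , u∉C)) (∈nb⁻ t∈nb))))
        (All.lookup holds j∈js))
    result : Growth Y L v (suc f) T js
    result with outside-C
    ... | b , b∈L , b∉C with exit conn-L v∈L (C₀⊆C (x∈⁅x⁆ v)) b∈L b∉C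
    ... | x , x∈L , x∉C , x~C = record
      { C = C ∪ ⁅ x ⁆ ; v∈C = ∪ˡ (C₀⊆C (x∈⁅x⁆ v)) ; C⊆L = ∪-lub C⊆X (⁅⁆⊆ x∈L)
      ; conn-C = connected-∪⁅⁆ connected x~C
      ; j = proj₁ found ; j∈js = proj₁ (proj₂ found) ; large = proj₂ (proj₂ found)
      ; bounded = λ i∈ → dom-∪ {a = 1} (dom-ball {T = ball x} (L⊆Y x∈L) id) (All.lookup holds i∈)
          λ t∈ → let t∈T , t∈nb = ∩⁻ t∈ in
            [ (λ t~C → ∪ʳ (∩⁺ t∈T (∈nb⁺ t~C))) , (λ t~x → ∪ˡ (∪ʳ (∈nb⁺ t~x))) ]′ (adj-∪ (∈nb⁻ t∈nb)) }
      where
      found : ∃ λ j → j ∈ˡ js × ¬ Dom Y (suc f) (T j ∩ nb (C ∪ ⁅ x ⁆))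
      found = find (All.¬All⇒Any¬ (λ i → dom? Y (suc f) (T i ∩ nb (C ∪ ⁅ x ⁆))) js (maximal x∈L x∉C x~C))

  -- Paths of connected sets

  Branch : (L C Z D : Subset n) → Set
  Branch L C Z D = Connected G D × D ⊆ L × Apart C D × ∃ λ w → w ∈ Z × w adj D

  record Separation (k : ℕ) (Y L R C : Subset n) : Set where
    field
      Z        : Subset n
      Z⊆L      : Z ⊆ L
      Z∉C      : ∀ {z} → z ∈ Z → z ∉ C
      Z~C      : ∀ {z} → z ∈ Z → z adj C
      Z-dom    : Dom Y k ((nb Z ∩ nb R) ∖ nb C)
      𝒟        : List (Subset n)
      ≤k       : length 𝒟 ≤ k
      branches : All (Branch L C Z) 𝒟
      covers   : Covers 𝒟 ((nb L ∩ nb R) ∖ nb (C ∪ Z))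

  -- `Z` is the boundary of `C` in `L`, and the candidates for `𝒟` are the components of `L` beyond
  -- it. Both bounds come from `cover`: first for the singletons of `Z` around `C`, then for the
  -- components around `C ∪ Z`.
  separate : ∀ {k} → CreatureFree G k → ∀ {Y L R C} → Connected G L → Connected G R → Connected G C →
             L ⊆ Y → Apart L R → C ⊆ L → Separation k Y L R C
  separate {k} free {Y} {L} {R} {C} conn-L conn-R conn-C L⊆Y L-apart C⊆L = result
    where
    Z X : Subset n
    Z = (L ∩ nb C) ∖ C
    X = L ∖ (C ∪ Z)
    Z⊆L : Z ⊆ L
    Z⊆L z∈ = proj₁ (∩⁻ (proj₁ (∖⁻ z∈)))
    Z~C : ∀ {z} → z ∈ Z → z adj C
    Z~C z∈ = ∈nb⁻ (proj₂ (∩⁻ (proj₁ (∖⁻ z∈))))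
    Q : Fin n → Subset n → Set
    Q u D = u ∈ D × Branch L C Z D
    branch : ∀ {u} → u ∈ X → ∃ (Q u)
    branch {u} u∈X = D , u∈D , connected , proj₁ ∘ ∖⁻ ∘ D⊆X , D-apart , boundary
      where
      -- With a trivial property, growth yields the component of `u` in `X`.
      open Grown (grow X {λ _ → Unit} (λ _ → yes tt) (⁅⁆⊆ u∈X) (connected-⁅⁆ u) tt) renaming (C to D; C₀⊆C to ⁅u⁆⊆D; C⊆X to D⊆X)
      u∈D : u ∈ D
      u∈D = ⁅u⁆⊆D (x∈⁅x⁆ u)
      D-apart : Apart C D
      D-apart c∈C d∈D = let d∈L , d∉ = ∖⁻ (D⊆X d∈D) in
        (λ { refl → d∉ (∪ˡ c∈C) }) ,
        (λ c~d → d∉ (∪ʳ (∖⁺ (∩⁺ d∈L (∈nb⁺ (_ , c∈C , ~-sym c~d))) (d∉ ∘ ∪ˡ))))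
      boundary : ∃ λ w → w ∈ Z × w adj D
      -- A walk in `L` towards `C` leaves `D` at a vertex of `Z`, because `D` is maximal in `X` and
      -- apart from `C`.
      boundary with exit conn-L (proj₁ (∖⁻ u∈X)) u∈D (C⊆L (proj₂ (proj₁ conn-C)))
                      (λ c∈D → proj₁ (D-apart (proj₂ (proj₁ conn-C)) c∈D) refl)
      ... | x , x∈L , x∉D , x~D with x ∈? C ∪ Z
      ...   | no x∉ = contradiction tt (maximal (∖⁺ x∈L x∉) x∉D x~D)
      ...   | yes x∈ = x , ∪-elim (λ x∈C → contradiction x~D (apart⇒¬adj D-apart x∈C)) id x∈ , x~D
    branches∃ : ∃ λ 𝒟 → All (λ D → ∃ λ u → u ∈ X × Q u D) 𝒟 × (∀ {u} → u ∈ˡ List.allFin n → u ∈ X → Any (Q u) 𝒟)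
    branches∃ = collect branch (List.allFin n)
    𝒟₀ : List (Subset n)
    𝒟₀ = proj₁ branches∃
    all-branches : All (Branch L C Z) 𝒟₀
    all-branches = All.map (λ (_ , _ , _ , b) → b) (proj₁ (proj₂ branches∃))
    cov₀ : Covers 𝒟₀ ((nb L ∩ nb R) ∖ nb (C ∪ Z))
    cov₀ {t} t∈ =
      let t∈LR , t∉ = ∖⁻ t∈
          u , u∈L , t~u = ∈nb⁻ (proj₁ (∩⁻ t∈LR))
      in Any.map (λ (u∈D , _) → u , u∈D , t~u)
           (proj₂ (proj₂ branches∃) (Mem.∈-allFin u) (∖⁺ u∈L λ u∈ → t∉ (∈nb⁺ (u , u∈ , t~u))))
    C∪Z⊆L : C ∪ Z ⊆ L
    C∪Z⊆L = ∪-lub C⊆L Z⊆L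
    subcover : ∃ λ 𝒟 → length 𝒟 ≤ k × All (_∈ˡ 𝒟₀) 𝒟 × Covers 𝒟 ((nb L ∩ nb R) ∖ nb (C ∪ Z))
    subcover = cover free (connected-∪-nbrs conn-C Z~C) conn-R (apart-mono C∪Z⊆L id L-apart) 𝒟₀
      (λ D∈ → let conn-D , D⊆L , _ , w , w∈Z , d , d∈D , w~d = All.lookup all-branches D∈ in
        conn-D , (w , d , ∪ʳ w∈Z , d∈D , inj₂ w~d) , apart-mono D⊆L id L-apart)
      _ (λ t∈ → let t∈LR , t∉ = ∖⁻ t∈ in ∈nb⁻ (proj₂ (∩⁻ t∈LR)) , t∉ ∘ ∈nb⁺) cov₀
    result : Separation k Y L R C
    result = record
      { Z = Z ; Z⊆L = Z⊆L ; Z∉C = proj₂ ∘ ∖⁻ ; Z~C = Z~C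
      ; Z-dom = cover-by-vertices free conn-C conn-R (apart-mono C⊆L id L-apart) (apart-mono Z⊆L id L-apart)
          (L⊆Y ∘ Z⊆L) Z~C (λ t∈ → let t∈ZR , t∉ = ∖⁻ t∈ in ∈nb⁻ (proj₂ (∩⁻ t∈ZR)) , t∉ ∘ ∈nb⁺)
          (proj₁ ∘ ∩⁻ ∘ proj₁ ∘ ∖⁻)
      ; 𝒟 = proj₁ subcover ; ≤k = proj₁ (proj₂ subcover)
      ; branches = All.map (All.lookup all-branches) (proj₁ (proj₂ (proj₂ subcover)))
      ; covers = proj₂ (proj₂ (proj₂ subcover)) }

  record Crossing (Y L : Subset n) (g : ℕ) (T : ℕ → Subset n) (js : List ℕ) : Set where
    field
      C D     : Subset n
      conn-C  : Connected G C
      conn-D  : Connected G D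
      C⊆L     : C ⊆ L
      D⊆L     : D ⊆ L
      C-apart : Apart C D
      j       : ℕ
      j∈js    : j ∈ˡ js
      large   : ¬ Dom Y g (T j ∩ (nb C ∩ nb D))

  -- Only the values at i < q are meaningful.
  record PathModel (_⊏_ : ℕ → ℕ → Set) (Y : Subset n) (f q : ℕ) (L : Subset n) (v : Fin n)
                   (T : ℕ → Subset n) (js : List ℕ) : Set where
    field
      C S      : ℕ → Subset n
      tag      : ℕ → ℕ
      conn     : ∀ {i} → i < q → Connected G (C i)
      C⊆L      : ∀ {i} → i < q → C i ⊆ L
      root     : 0 < q → v ∈ C 0
      touch    : ∀ {i} → suc i < q → Touch (C i) (C (suc i))
      disjoint : ∀ {i j u} → i < j → j < q → u ∈ C i → u ∉ C j
      far      : ∀ {i j} → suc i < j → j < q → Apart (C i) (C j)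
      tag∈     : ∀ {i} → i < q → tag i ∈ˡ js
      tag-mono : ∀ {i j} → i < j → j < q → tag i ⊏ tag j
      S⊆T      : ∀ {i} → i < q → S i ⊆ T (tag i)
      S~C      : ∀ {i t} → i < q → t ∈ S i → t adj C i
      S≁C      : ∀ {i j t} → i < q → j < q → i ≢ j → t ∈ S i → ¬ t adj C j
      large    : ∀ {i} → i < q → ¬ Dom Y f (S i)

  trivial-path : ∀ {_⊏_ Y f L v T js} → PathModel _⊏_ Y f 0 L v T js
  trivial-path = record
    { C = λ _ → ⊥ ; S = λ _ → ⊥ ; tag = id ; conn = λ () ; C⊆L = λ () ; root = λ () ; touch = λ () ; disjoint = λ _ ()
    ; far = λ _ () ; tag∈ = λ () ; tag-mono = λ _ () ; S⊆T = λ () ; S~C = λ () ; S≁C = λ () ; large = λ () }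

  -- The data shared by `extend-path` and `absorb-path`: `C` leads from `v` to a neighbour `w`,
  -- where a path inside `D` and `w` is rooted.
  record Link (L : Subset n) (v : Fin n) (T : ℕ → Subset n) (js : List ℕ) : Set where
    field
      C D     : Subset n
      w       : Fin n
      T′      : ℕ → Subset n
      js′     : List ℕ
      v∈C     : v ∈ C
      C⊆L     : C ⊆ L
      conn-C  : Connected G C
      D⊆L     : D ⊆ L
      C-apart : Apart C D
      w∈L     : w ∈ L
      w∉C     : w ∉ C
      w~C     : w adj C
      T′⊆T    : ∀ {i} → T′ i ⊆ T i
      T′≁C    : ∀ {i t} → t ∈ T′ i → ¬ t adj C
      js′⊆js  : ∀ {i} → i ∈ˡ js′ → i ∈ˡ js

  module _ {L : Subset n} {v : Fin n} {T : ℕ → Subset n} {js : List ℕ} (link : Link L v T js)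
           {_⊏_ : ℕ → ℕ → Set} {Y : Subset n} {f q : ℕ}
           (path : PathModel _⊏_ Y f q (Link.D link ∪ ⁅ Link.w link ⁆) (Link.w link) (Link.T′ link) (Link.js′ link)) where
    open Link link
    private module P = PathModel path

    private
      C-disjoint : ∀ {i u} → i < q → u ∈ C → u ∉ P.C i
      C-disjoint i<q u∈C u∈Ci = ∪-elim (λ u∈D → proj₁ (C-apart u∈C u∈D) refl)
        (λ u∈w → w∉C (subst (_∈ C) (∈⁅⁆⁻ u∈w) u∈C)) (P.C⊆L i<q u∈Ci)

      C-far : ∀ {i} → 0 < i → i < q → Apart C (P.C i)
      C-far 0<i i<q u∈C x∈Ci = ∪-elim (λ x∈D → C-apart u∈C x∈D)
        -- `w` lies in the first set of the path, hence in no later one.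
        (λ x∈w → contradiction (subst (_∈ P.C _) (∈⁅⁆⁻ x∈w) x∈Ci)
          (P.disjoint 0<i i<q (P.root (ℕ.<-trans 0<i i<q)))) (P.C⊆L i<q x∈Ci)

      C-touch : 0 < q → Touch C (P.C 0)
      C-touch 0<q = let c , c∈C , w~c = w~C in c , w , c∈C , P.root 0<q , inj₂ (~-sym w~c)

      lift⊆L : ∀ {i} → i < q → P.C i ⊆ L
      lift⊆L i<q = ∪-lub D⊆L (⁅⁆⊆ w∈L) ∘ P.C⊆L i<q

    extend-path : ∀ {j S₀} → j ∈ˡ js → (∀ {i} → i ∈ˡ js′ → j ⊏ i) → S₀ ⊆ T j → (∀ {t} → t ∈ S₀ → t adj C) →
                  (∀ {t} → t ∈ S₀ → ¬ t adj (D ∪ ⁅ w ⁆)) → ¬ Dom Y f S₀ → PathModel _⊏_ Y f (suc q) L v T js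
    extend-path {j} {S₀} j∈ j⊏ S₀⊆T S₀~C S₀≁D S₀-large = record
      { C = C ◂ P.C ; S = S₀ ◂ P.S ; tag = j ◂ P.tag
      ; conn = λ { {zero} _ → conn-C ; {suc i} (s≤s lt) → P.conn lt }
      ; C⊆L = λ { {zero} _ → C⊆L ; {suc i} (s≤s lt) → lift⊆L lt }
      ; root = λ _ → v∈C
      ; touch = λ { {zero} (s≤s lt) → C-touch lt ; {suc i} (s≤s lt) → P.touch lt }
      ; disjoint = λ { {zero} {suc j} _ (s≤s lt) → C-disjoint lt ; {suc i} {suc j} (s≤s lt) (s≤s lt′) → P.disjoint lt lt′ }
      ; far = λ { {zero} {suc j} (s≤s lt) (s≤s lt′) → C-far lt lt′ ; {suc i} {suc j} (s≤s lt) (s≤s lt′) → P.far lt lt′ }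
      ; tag∈ = λ { {zero} _ → j∈ ; {suc i} (s≤s lt) → js′⊆js (P.tag∈ lt) }
      ; tag-mono = λ { {zero} {suc j} _ (s≤s lt) → j⊏ (P.tag∈ lt) ; {suc i} {suc j} (s≤s lt) (s≤s lt′) → P.tag-mono lt lt′ }
      ; S⊆T = λ { {zero} _ → S₀⊆T ; {suc i} (s≤s lt) → T′⊆T ∘ P.S⊆T lt }
      ; S~C = λ { {zero} _ → S₀~C ; {suc i} (s≤s lt) → P.S~C lt }
      ; S≁C = λ { {zero} {zero} _ _ i≢j _ → contradiction refl i≢j
                ; {zero} {suc j} _ (s≤s lt) _ t∈ → S₀≁D t∈ ∘ adj-mono (P.C⊆L lt)
                ; {suc i} {zero} (s≤s lt) _ _ t∈ → T′≁C (P.S⊆T lt t∈)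
                ; {suc i} {suc j} (s≤s lt) (s≤s lt′) i≢j → P.S≁C lt lt′ (i≢j ∘ cong suc) }
      ; large = λ { {zero} _ → S₀-large ; {suc i} (s≤s lt) → P.large lt }
      }

    -- For an index that does not fit the order, `C` contributes no part and is merged into the
    -- first set, which moves the root to `v`. Nothing in `T′` is attached to `C`, so the parts stay
    -- private.
    absorb-path : PathModel _⊏_ Y f q L v T js
    absorb-path = record
      { C = C₊ ; S = P.S ; tag = P.tag
      ; conn = λ { {zero} lt → connected-∪ conn-C (P.conn lt) (C-touch lt) ; {suc i} → P.conn }
      ; C⊆L = λ { {zero} lt → ∪-lub C⊆L (lift⊆L lt) ; {suc i} → lift⊆L }
      ; root = λ _ → ∪ˡ v∈C
      ; touch = λ { {zero} lt → touch-mono ∪ʳ id (P.touch lt) ; {suc i} → P.touch }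
      ; disjoint = λ { {zero} {suc j} lt lt′ u∈ → ∪-elim (C-disjoint lt′) (P.disjoint lt lt′) u∈
                     ; {suc i} {suc j} → P.disjoint }
      ; far = λ { {zero} {suc j} lt lt′ → apart-∪ˡ (C-far (s≤s z≤n) lt′) (P.far lt lt′) ; {suc i} {suc j} → P.far }
      ; tag∈ = js′⊆js ∘ P.tag∈ ; tag-mono = P.tag-mono
      ; S⊆T = λ lt → T′⊆T ∘ P.S⊆T lt
      ; S~C = λ { {zero} lt t∈ → adj-mono ∪ʳ (P.S~C lt t∈) ; {suc i} → P.S~C }
      ; S≁C = λ { {j = zero} lt lt′ i≢j t∈ t~ → [ T′≁C (P.S⊆T lt t∈) , P.S≁C lt lt′ i≢j t∈ ]′ (adj-∪ t~)
                ; {j = suc j} → P.S≁C }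
      ; large = P.large
      }
      where
      C₊ : ℕ → Subset n
      C₊ zero    = C ∪ P.C 0
      C₊ (suc i) = P.C (suc i)

  -- A path starts with C and continues from w into D; only the indices in js′ are kept.
  record Step (Y L R : Subset n) (v : Fin n) (f F N : ℕ) (T : ℕ → Subset n) (js : List ℕ) : Set where
    field
      C D S   : Subset n
      w       : Fin n
      j       : ℕ
      T′      : ℕ → Subset n
      js′     : List ℕ
      v∈C     : v ∈ C
      C⊆L     : C ⊆ L
      conn-C  : Connected G C
      D⊆L     : D ⊆ L
      conn-D  : Connected G D
      C-apart : Apart C D
      w∈L     : w ∈ L
      w∉C     : w ∉ C
      w~C     : w adj C
      w~D     : w adj D
      T′⊆T    : ∀ {i} → T′ i ⊆ T i
      T′≁C    : ∀ {i t} → t ∈ T′ i → ¬ t adj C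
      T′-good : ∀ {i} → i ∈ˡ js′ → T′ i ⊆ nb D × T′ i ⊆ nb R × ¬ Dom Y F (T′ i)
      j∈js    : j ∈ˡ js
      js′⊆js  : ∀ {i} → i ∈ˡ js′ → i ∈ˡ js
      j∉js′   : ∀ {i} → i ∈ˡ js′ → i ≢ j
      unique  : Unique js′
      long    : N ≤ length js′
      S⊆T     : S ⊆ T j
      S~C     : ∀ {t} → t ∈ S → t adj C
      S≁D     : ∀ {t} → t ∈ S → ¬ t adj (D ∪ ⁅ w ⁆)
      S-large : ¬ Dom Y f S

  module _ {k g f F N : ℕ} {Y L R : Subset n} {v : Fin n} {T : ℕ → Subset n} {js : List ℕ} (L⊆Y : L ⊆ Y)
    (growth : Growth Y L v (suc (g + f)) T js)
    (separation : Separation k Y L R (Growth.C growth))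
    (T-good : ∀ {j} → j ∈ˡ js → T j ⊆ nb L × T j ⊆ nb R × ¬ Dom Y (suc (suc (g + f)) + (k + k * F)) (T j))
    (unique : Unique js) (long : 2 + k * N ≤ length js) where
    open Growth growth
    open Separation separation

    private
      others? : ∀ i → Dec (i ≢ j)
      others? i = ¬? (i ℕ.≟ j)

      js₁ : List ℕ
      js₁ = filter others? js

      T₁ : ℕ → Subset n
      T₁ i = T i ∖ nb (C ∪ Z)

      Heavy : Subset n → ℕ → Set
      Heavy D i = ¬ Dom Y F (T₁ i ∩ nb D)

      heavy? : ∀ D → Decidable (Heavy D)
      heavy? D i = ¬? (dom? Y F (T₁ i ∩ nb D))

      T₁⊆ : ∀ {i} → i ∈ˡ js → T₁ i ⊆ (nb L ∩ nb R) ∖ nb (C ∪ Z)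
      T₁⊆ i∈ t∈ = let t∈T , t∉ = ∖⁻ t∈ ; T⊆L , T⊆R , _ = T-good i∈ in ∖⁺ (∩⁺ (T⊆L t∈T) (T⊆R t∈T)) t∉

      T-split : ∀ {i} → i ∈ˡ js → T i ⊆ (T i ∩ nb C) ∪ (((nb Z ∩ nb R) ∖ nb C) ∪ T₁ i)
      T-split i∈ {t} t∈ with t ∈? nb C | t ∈? nb Z
      ... | yes p | _     = ∪ˡ (∩⁺ t∈ p)
      ... | no ¬p | yes q = ∪ʳ (∪ˡ (∖⁺ (∩⁺ q (proj₁ (proj₂ (T-good i∈)) t∈)) ¬p))
      ... | no ¬p | no ¬q = ∪ʳ (∪ʳ (∖⁺ t∈ λ t∈nb → [ ¬p ∘ ∈nb⁺ , ¬q ∘ ∈nb⁺ ]′ (adj-∪ (∈nb⁻ t∈nb))))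

      T₁-large : ∀ {i} → i ∈ˡ js → ¬ Dom Y (k * F) (T₁ i)
      -- What is attached to `C` or to `Z` is accounted for by the first two summands of the
      -- threshold.
      T₁-large i∈ d = proj₂ (proj₂ (T-good i∈)) (dom-∪ (bounded i∈) (dom-∪ Z-dom d id) (T-split i∈))

      js₁-heavy : All (λ i → Any (λ D → Heavy D i) 𝒟) js₁
      js₁-heavy = All.tabulate λ {i} i∈₁ →
        let i∈ = proj₁ (Mem.∈-filter⁻ others? {xs = js} i∈₁) in
        All.¬All⇒Any¬ (λ D → dom? Y F (T₁ i ∩ nb D)) 𝒟 λ all → T₁-large i∈
          (dom-mono (ℕ.*-monoˡ-≤ F ≤k) id (dom-covers 𝒟 all (λ t∈ → covers (T₁⊆ i∈ t∈))))

      js₁-long : length 𝒟 * N < length js₁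
      -- Of the two spare indices, one is `j` and the other makes the inequality strict.
      js₁-long = ℕ.≤-trans (s≤s (ℕ.*-monoˡ-≤ N ≤k)) (s≤s⁻¹ (ℕ.≤-trans long (length≤1+filter others? id unique)))

      module _ (D : Subset n) (js₂-long : N ≤ length (filter (heavy? D) js₁)) where

        at-branch : Branch L C Z D → Dec (Dom Y g (T j ∩ (nb C ∩ nb D))) →
                    Crossing Y L g T js ⊎ Step Y L R v f F N T js
        at-branch (conn-D , D⊆L , C-apart , _) (no crossing) = inj₁ record
          { C = C ; D = D ; conn-C = conn-C ; conn-D = conn-D ; C⊆L = C⊆L ; D⊆L = D⊆L ; C-apart = C-apart
          ; j = j ; j∈js = j∈js ; large = crossing }
        at-branch (conn-D , D⊆L , C-apart , w , w∈Z , w~D) (yes small) = inj₂ record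
          { C = C ; D = D ; S = S ; w = w ; j = j ; T′ = λ i → T₁ i ∩ nb D ; js′ = filter (heavy? D) js₁
          ; v∈C = v∈C ; C⊆L = C⊆L ; conn-C = conn-C ; D⊆L = D⊆L ; conn-D = conn-D ; C-apart = C-apart
          ; w∈L = Z⊆L w∈Z ; w∉C = Z∉C w∈Z ; w~C = Z~C w∈Z ; w~D = w~D
          ; T′⊆T = T′⊆T
          ; T′≁C = λ t∈ t~C → proj₂ (∖⁻ (proj₁ (∩⁻ t∈))) (∈nb⁺ (adj-mono ∪ˡ t~C))
          ; T′-good = λ i∈₂ → let i∈ , _ , heavy = js₂⁻ i∈₂ in
              proj₂ ∘ ∩⁻ , proj₁ (proj₂ (T-good i∈)) ∘ T′⊆T , heavy
          ; j∈js = j∈js ; js′⊆js = proj₁ ∘ js₂⁻ ; j∉js′ = proj₁ ∘ proj₂ ∘ js₂⁻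
          ; unique = Unique.filter⁺ (heavy? D) (Unique.filter⁺ others? unique) ; long = js₂-long
          ; S⊆T = proj₁ ∘ ∩⁻ ∘ proj₁ ∘ ∖⁻ ∘ proj₁ ∘ ∖⁻
          ; S~C = ∈nb⁻ ∘ proj₂ ∘ ∩⁻ ∘ proj₁ ∘ ∖⁻ ∘ proj₁ ∘ ∖⁻
          ; S≁D = λ t∈ t~ → let t∈₁ , t∉ball = ∖⁻ t∈ in
              [ proj₂ (∖⁻ t∈₁) ∘ ∈nb⁺ , t∉ball ∘ ∪ʳ ∘ ∈nb⁺ ]′ (adj-∪ t~)
          -- The part of `T j` at `C` exceeds `1 + g + f`: one goes to the ball of `w` and `g` to
          -- what is attached to `D` as well, so `S` still exceeds `f`.
          ; S-large = λ d → large (dom-∪ (dom-ball {T = ball w} (L⊆Y (Z⊆L w∈Z)) id) (dom-∪ small d id) split)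
          }
          where
          S : Subset n
          S = ((T j ∩ nb C) ∖ nb D) ∖ ball w
          T′⊆T : ∀ {i} → T₁ i ∩ nb D ⊆ T i
          T′⊆T t∈ = proj₁ (∖⁻ (proj₁ (∩⁻ t∈)))
          js₂⁻ : ∀ {i} → i ∈ˡ filter (heavy? D) js₁ → i ∈ˡ js × i ≢ j × Heavy D i
          js₂⁻ i∈₂ =
            let i∈₁ , heavy = Mem.∈-filter⁻ (heavy? D) {xs = js₁} i∈₂
                i∈ , i≢j = Mem.∈-filter⁻ others? {xs = js} i∈₁
            in i∈ , i≢j , heavy
          split : T j ∩ nb C ⊆ ball w ∪ ((T j ∩ (nb C ∩ nb D)) ∪ S)
          split {t} t∈ with t ∈? ball w | t ∈? nb D
          ... | yes p | _     = ∪ˡ p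
          ... | no ¬p | yes q = let t∈T , t∈C = ∩⁻ t∈ in ∪ʳ (∪ˡ (∩⁺ t∈T (∩⁺ t∈C q)))
          ... | no ¬p | no ¬q = ∪ʳ (∪ʳ (∖⁺ (∖⁺ t∈ ¬q) ¬p))

    -- By pigeonhole some branch `D` is heavy for `N` indices other than `j`. Either `T j` has a
    -- large part attached to both `C` and `D`, or most of its part at `C` is not attached to `D`,
    -- and removing the ball of `w` makes it private to `C`.
    step-or-crossing : Crossing Y L g T js ⊎ Step Y L R v f F N T js
    step-or-crossing = let D , D∈ , js₂-long = pigeonhole heavy? N 𝒟 js₁ js₁-heavy js₁-long in
      at-branch D js₂-long (All.lookup branches D∈) (dom? Y g _)

  -- An Erdős–Szekeres recursion: after the first set of the path has been found, only
  -- the indices larger, or only those smaller, than its tag are kept.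
  module _ {k : ℕ} (free : CreatureFree G k) {Y R : Subset n} (conn-R : Connected G R) (g f : ℕ) where

    path-or-crossing : ∀ a b {L v T js} → Connected G L → v ∈ L → L ⊆ Y → Apart L R →
      (∀ {j} → j ∈ˡ js → T j ⊆ nb L × T j ⊆ nb R × ¬ Dom Y (sizeThreshold k g f a b) (T j)) →
      Unique js → indexThreshold k a b ≤ length js →
      Crossing Y L g T js ⊎ PathModel _<_ Y f a L v T js ⊎ PathModel _>_ Y f b L v T js
    path-or-crossing zero b _ _ _ _ _ _ _ = inj₂ (inj₁ trivial-path)
    path-or-crossing (suc a) zero _ _ _ _ _ _ _ = inj₂ (inj₂ trivial-path)
    path-or-crossing (suc a) (suc b) {L} {v} {T} {[]} _ _ _ _ _ _ ()
    path-or-crossing (suc a) (suc b) {L} {v} {T} {js@(j₀ ∷ _)} conn-L v∈L L⊆Y L-apart T-good unique long =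
      -- The side of `j` on which enough indices lie is known only after the step, so the sums
      -- provide for both recursive calls.
      [ inj₁ , proceed ]′ (step-or-crossing {F = Fₐ + F_b} L⊆Y growing
        (separate free conn-L conn-R (Growth.conn-C growing) L⊆Y L-apart (Growth.C⊆L growing)) T-good unique long)
      where
      Fₐ F_b Nₐ N_b : ℕ
      Fₐ = sizeThreshold k g f a (suc b)
      F_b = sizeThreshold k g f (suc a) b
      Nₐ = indexThreshold k a (suc b)
      N_b = indexThreshold k (suc a) b
      Result : Set
      Result = Crossing Y L g T js ⊎ PathModel _<_ Y f (suc a) L v T js ⊎ PathModel _>_ Y f (suc b) L v T js
      growing : Growth Y L v (suc (g + f)) T js
      growing = growth conn-L v∈L L⊆Y (j₀ , here refl , λ d → let T⊆L , _ , T-large = T-good (here refl) in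
        T-large (dom-mono (ℕ.≤-trans (ℕ.n≤1+n _) (ℕ.m≤m+n _ _)) (λ t∈ → ∩⁺ t∈ (T⊆L t∈)) d))

      proceed : Step Y L R v f (Fₐ + F_b) (Nₐ + N_b) T js → Result
      proceed step = by-length (Nₐ ℕ.≤? length (filter larger? js′))
        where
        open Step step renaming (unique to unique′; long to long′)
        larger? : ∀ i → Dec (j < i)
        larger? = j ℕ.<?_
        smaller? : ∀ i → Dec (¬ j < i)
        smaller? i = ¬? (larger? i)
        L′⊆L : D ∪ ⁅ w ⁆ ⊆ L
        L′⊆L = ∪-lub D⊆L (⁅⁆⊆ w∈L)
        link : ∀ js₃ → (∀ {i} → i ∈ˡ js₃ → i ∈ˡ js′) → Link L v T js
        link js₃ js₃⊆ = record
          { C = C ; D = D ; w = w ; T′ = T′ ; js′ = js₃ ; v∈C = v∈C ; C⊆L = C⊆L ; conn-C = conn-C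
          ; D⊆L = D⊆L ; C-apart = C-apart ; w∈L = w∈L ; w∉C = w∉C ; w~C = w~C ; T′⊆T = T′⊆T ; T′≁C = T′≁C
          ; js′⊆js = js′⊆js ∘ js₃⊆ }
        lift-crossing : ∀ {js₃} → (∀ {i} → i ∈ˡ js₃ → i ∈ˡ js′) → Crossing Y (D ∪ ⁅ w ⁆) g T′ js₃ → Crossing Y L g T js
        lift-crossing js₃⊆ crossing = record
          { C = X.C ; D = X.D ; conn-C = X.conn-C ; conn-D = X.conn-D ; C⊆L = L′⊆L ∘ X.C⊆L ; D⊆L = L′⊆L ∘ X.D⊆L
          ; C-apart = X.C-apart ; j = X.j ; j∈js = js′⊆js (js₃⊆ X.j∈js)
          ; large = X.large ∘ dom-mono ℕ.≤-refl (λ t∈ → let t∈T , t∈X = ∩⁻ t∈ in ∩⁺ (T′⊆T t∈T) t∈X) }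
          where module X = Crossing crossing
        good : ∀ {m js₃} → m ≤ Fₐ + F_b → (∀ {i} → i ∈ˡ js₃ → i ∈ˡ js′) → ∀ {i} → i ∈ˡ js₃ →
               T′ i ⊆ nb (D ∪ ⁅ w ⁆) × T′ i ⊆ nb R × ¬ Dom Y m (T′ i)
        good m≤ js₃⊆ i∈ = let T⊆D , T⊆R , T-large = T′-good (js₃⊆ i∈) in
          (λ t∈ → ∈nb⁺ (adj-mono ∪ˡ (∈nb⁻ (T⊆D t∈)))) , T⊆R , T-large ∘ dom-mono m≤ id
        larger⁻ : ∀ {i} → i ∈ˡ filter larger? js′ → i ∈ˡ js′ × j < i
        larger⁻ = Mem.∈-filter⁻ larger? {xs = js′}
        smaller⁻ : ∀ {i} → i ∈ˡ filter smaller? js′ → i ∈ˡ js′ × j > i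
        smaller⁻ i∈ = let i∈′ , j≮i = Mem.∈-filter⁻ smaller? {xs = js′} i∈ in
          i∈′ , ℕ.≤∧≢⇒< (ℕ.≮⇒≥ j≮i) (j∉js′ i∈′)
        by-length : Dec (Nₐ ≤ length (filter larger? js′)) → Result
        -- All remaining tags exceed `j`: `C` can head an increasing path, while a decreasing path
        -- absorbs it. Below `j` the roles are exchanged.
        by-length (yes many) =
          [ inj₁ ∘ lift-crossing (proj₁ ∘ larger⁻)
          , [ (λ path → inj₂ (inj₁ (extend-path (link _ (proj₁ ∘ larger⁻)) path j∈js (proj₂ ∘ larger⁻) S⊆T S~C S≁D S-large)))
            , (λ path → inj₂ (inj₂ (absorb-path (link _ (proj₁ ∘ larger⁻)) path))) ]′ ]′
          (path-or-crossing a (suc b) (connected-∪⁅⁆ conn-D w~D) (∪ʳ (x∈⁅x⁆ w)) (L⊆Y ∘ L′⊆L) (apart-mono L′⊆L id L-apart)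
            (good (ℕ.m≤m+n Fₐ F_b) (proj₁ ∘ larger⁻)) (Unique.filter⁺ larger? unique′) many)
        by-length (no few) =
          [ inj₁ ∘ lift-crossing (proj₁ ∘ smaller⁻)
          , [ (λ path → inj₂ (inj₁ (absorb-path (link _ (proj₁ ∘ smaller⁻)) path)))
            , (λ path → inj₂ (inj₂ (extend-path (link _ (proj₁ ∘ smaller⁻)) path j∈js (proj₂ ∘ smaller⁻) S⊆T S~C S≁D S-large))) ]′ ]′
          (path-or-crossing (suc a) b (connected-∪⁅⁆ conn-D w~D) (∪ʳ (x∈⁅x⁆ w)) (L⊆Y ∘ L′⊆L) (apart-mono L′⊆L id L-apart)
            (good (ℕ.m≤n+m F_b Fₐ) (proj₁ ∘ smaller⁻)) (Unique.filter⁺ smaller? unique′)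
            (ℕ.+-cancelˡ-≤ Nₐ _ _ (ℕ.≤-trans long′ (ℕ.≤-trans (ℕ.≤-reflexive (length-filter-split larger? js′))
              (ℕ.+-monoˡ-≤ _ (ℕ.<⇒≤ (ℕ.≰⇒> few)))))))

  -- Ladders

  branch-sets⇒minor : ∀ {W} {H : Graph W} → DecidableEquality W → (M : W → Subset n) → (∀ u → Dec (∃ λ h → u ∈ M h)) →
    (∀ h → Connected G (M h)) → (∀ {u h h′} → u ∈ M h → u ∈ M h′ → h ≡ h′) →
    (∀ {h h′} → Graph._~_ H h h′ → ∃₂ λ u v → u ∈ M h × v ∈ M h′ × u ~ v) →
    (∀ {u v h h′} → u ∈ M h → v ∈ M h′ → h ≢ h′ → u ~ v → Graph._~_ H h h′) →
    InducedMinor H G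
  branch-sets⇒minor {W} {H} _≟ᵂ_ M search conn unique-branch edge⁺ edge⁻ = model⇒minor _≟ᵂ_ G φ record
    { surjective = λ h → let (u , u∈) , _ = conn h in u , φ⁺ u∈
    ; connected = λ {_} {_} {h} φu φv → Star.map (λ (a∈ , b∈ , a~b) → a~b , φ⁺ a∈ , φ⁺ b∈) (proj₂ (conn h) (φ⁻ φu) (φ⁻ φv))
    ; edge⁺ = λ h~h′ → let u , v , u∈ , v∈ , u~v = edge⁺ h~h′ in u , v , φ⁺ u∈ , φ⁺ v∈ , u~v
    ; edge⁻ = λ φu φv → edge⁻ (φ⁻ φu) (φ⁻ φv)
    }
    where
    φ : Fin n → Maybe W
    φ u with search u
    ... | yes (h , _) = just h
    ... | no _        = nothing
    φ⁻ : ∀ {u h} → φ u ≡ just h → u ∈ M h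
    φ⁻ {u} φu with search u
    φ⁻ {u} refl | yes (h , u∈) = u∈
    φ⁺ : ∀ {u h} → u ∈ M h → φ u ≡ just h
    φ⁺ {u} u∈ with search u
    ... | yes (h′ , u∈′) = cong just (unique-branch u∈′ u∈)
    ... | no none        = contradiction (_ , u∈) none

  record Chain (m : ℕ) (C : ℕ → Subset n) : Set where
    field
      conn     : ∀ {i} → i < m → Connected G (C i)
      touch    : ∀ {i} → suc i < m → Touch (C i) (C (suc i))
      disjoint : ∀ {i j u} → i < j → j < m → u ∈ C i → u ∉ C j
      far      : ∀ {i j} → suc i < j → j < m → Apart (C i) (C j)

  record Ladder (k : ℕ) : Set where
    field
      left right  : ℕ → Subset n
      rung        : ℕ → Fin n
      left-chain  : Chain k left
      right-chain : Chain k right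
      apart       : ∀ {i j} → i < k → j < k → Apart (left i) (right j)
      rung~left   : ∀ {i} → i < k → rung i adj left i
      rung≁left   : ∀ {i j} → i < k → j < k → i ≢ j → ¬ rung i adj left j
      rung~right  : ∀ {i} → i < k → rung i adj right i
      rung≁right  : ∀ {i j} → i < k → j < k → i ≢ j → ¬ rung i adj right j
      independent : ∀ {i j} → i < k → j < k → ¬ rung i ~ rung j

  module _ {k : ℕ} {C : ℕ → Subset n} (chain : Chain k C) where
    open Chain chain

    chain-unique : ∀ {i j : Fin k} {u} → u ∈ C (toℕ i) → u ∈ C (toℕ j) → i ≡ j
    chain-unique {i} {j} u∈ u∈′ with ℕ.<-cmp (toℕ i) (toℕ j)
    ... | tri< i<j _ _ = contradiction u∈′ (disjoint i<j (Fin.toℕ<n j) u∈)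
    ... | tri≈ _ i≡j _ = Fin.toℕ-injective i≡j
    ... | tri> _ _ j<i = contradiction u∈ (disjoint j<i (Fin.toℕ<n i) u∈′)

    chain-edge⁺ : ∀ {i j : Fin k} → toℕ j ≡ suc (toℕ i) → ∃₂ λ u v → u ∈ C (toℕ i) × v ∈ C (toℕ j) × u ~ v
    chain-edge⁺ {i} {j} j≡ with touch (subst (_< k) j≡ (Fin.toℕ<n j))
    ... | u , v , u∈ , v∈ , inj₁ refl = contradiction v∈ (disjoint (ℕ.n<1+n _) (subst (_< k) j≡ (Fin.toℕ<n j)) u∈)
    ... | u , v , u∈ , v∈ , inj₂ u~v  = u , v , u∈ , subst (λ i → v ∈ C i) (sym j≡) v∈ , u~v

    chain-edge⁻ : ∀ {i j : Fin k} {u v} → u ∈ C (toℕ i) → v ∈ C (toℕ j) → i ≢ j → u ~ v →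
                  toℕ j ≡ suc (toℕ i) ⊎ toℕ i ≡ suc (toℕ j)
    chain-edge⁻ {i} {j} u∈ v∈ i≢j u~v with ℕ.<-cmp (toℕ i) (toℕ j)
    ... | tri≈ _ i≡j _ = contradiction (Fin.toℕ-injective i≡j) i≢j
    ... | tri< i<j _ _ with ℕ.m≤n⇒m<n∨m≡n i<j
    ...   | inj₁ far<  = contradiction u~v (proj₂ (far far< (Fin.toℕ<n j) u∈ v∈))
    ...   | inj₂ close = inj₁ (sym close)
    chain-edge⁻ {i} {j} u∈ v∈ i≢j u~v | tri> _ _ j<i with ℕ.m≤n⇒m<n∨m≡n j<i
    ...   | inj₁ far<  = contradiction (~-sym u~v) (proj₂ (far far< (Fin.toℕ<n i) v∈ u∈))
    ...   | inj₂ close = inj₂ (sym close)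

  -- The branch sets are the chain sets and the single rungs. A rung lies in neither chain, since it
  -- has neighbours in both and the chains are apart.
  ladder⇒minor : ∀ {k} → Ladder k → InducedMinor (skinnyLadder k) G
  ladder⇒minor {k} ladder = branch-sets⇒minor _≟ᴸ_ M search conn unique-branch edge⁺ edge⁻
    where
    open Ladder ladder
    module L = Chain left-chain
    module R = Chain right-chain
    M : LadderVertex k → Subset n
    M (ℓ i) = left (toℕ i)
    M (s i) = ⁅ rung (toℕ i) ⁆
    M (r i) = right (toℕ i)
    lt : ∀ (i : Fin k) → toℕ i < k
    lt = Fin.toℕ<n
    toℕ≢ : ∀ {i j : Fin k} → i ≢ j → toℕ i ≢ toℕ j
    toℕ≢ i≢j = i≢j ∘ Fin.toℕ-injective
    rung∉left : ∀ i j → rung (toℕ i) ∉ left (toℕ j)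
    rung∉left i j z∈ = apart⇒¬adj (apart (lt j) (lt i)) z∈ (rung~right (lt i))
    rung∉right : ∀ i j → rung (toℕ i) ∉ right (toℕ j)
    rung∉right i j z∈ = apart⇒¬adj (apart-sym (apart (lt i) (lt j))) z∈ (rung~left (lt i))
    search : ∀ u → Dec (∃ λ h → u ∈ M h)
    search u with any? (λ i → u ∈? M (ℓ i)) | any? (λ i → u ∈? M (s i)) | any? (λ i → u ∈? M (r i))
    ... | yes (i , u∈) | _ | _ = yes (ℓ i , u∈)
    ... | no _ | yes (i , u∈) | _ = yes (s i , u∈)
    ... | no _ | no _ | yes (i , u∈) = yes (r i , u∈)
    ... | no ¬ℓ | no ¬s | no ¬r = no λ { (ℓ i , u∈) → ¬ℓ (i , u∈) ; (s i , u∈) → ¬s (i , u∈) ; (r i , u∈) → ¬r (i , u∈) }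
    conn : ∀ h → Connected G (M h)
    conn (ℓ i) = L.conn (lt i)
    conn (s i) = connected-⁅⁆ _
    conn (r i) = R.conn (lt i)
    unique-branch : ∀ {u h h′} → u ∈ M h → u ∈ M h′ → h ≡ h′
    unique-branch {h = ℓ i} {ℓ j} u∈ u∈′ = cong ℓ (chain-unique left-chain u∈ u∈′)
    unique-branch {h = ℓ i} {s j} u∈ u∈′ = contradiction (subst (_∈ left (toℕ i)) (∈⁅⁆⁻ u∈′) u∈) (rung∉left j i)
    unique-branch {h = ℓ i} {r j} u∈ u∈′ = contradiction refl (proj₁ (apart (lt i) (lt j) u∈ u∈′))
    unique-branch {h = s i} {ℓ j} u∈ u∈′ = contradiction (subst (_∈ left (toℕ j)) (∈⁅⁆⁻ u∈) u∈′) (rung∉left i j)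
    unique-branch {h = s i} {s j} u∈ u∈′ = cong s (decidable-stable (i ≟ j) λ i≢j →
      rung≁left (lt i) (lt j) (toℕ≢ i≢j) (subst (_adj left (toℕ j)) (trans (sym (∈⁅⁆⁻ u∈′)) (∈⁅⁆⁻ u∈)) (rung~left (lt j))))
    unique-branch {h = s i} {r j} u∈ u∈′ = contradiction (subst (_∈ right (toℕ j)) (∈⁅⁆⁻ u∈) u∈′) (rung∉right i j)
    unique-branch {h = r i} {ℓ j} u∈ u∈′ = contradiction refl (proj₁ (apart (lt j) (lt i) u∈′ u∈))
    unique-branch {h = r i} {s j} u∈ u∈′ = contradiction (subst (_∈ right (toℕ i)) (∈⁅⁆⁻ u∈′) u∈) (rung∉right j i)
    unique-branch {h = r i} {r j} u∈ u∈′ = cong r (chain-unique right-chain u∈ u∈′)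
    edge : ∀ {h h′} → LadderEdge h h′ → ∃₂ λ u v → u ∈ M h × v ∈ M h′ × u ~ v
    edge (ℓℓ j≡) = chain-edge⁺ left-chain j≡
    edge (rr j≡) = chain-edge⁺ right-chain j≡
    edge (ℓs i)  = let u , u∈ , z~u = rung~left (lt i) in u , _ , u∈ , x∈⁅x⁆ _ , ~-sym z~u
    edge (sr i)  = let u , u∈ , z~u = rung~right (lt i) in _ , u , x∈⁅x⁆ _ , u∈ , z~u
    edge⁺ : ∀ {h h′} → SymClosure LadderEdge h h′ → ∃₂ λ u v → u ∈ M h × v ∈ M h′ × u ~ v
    edge⁺ (fwd e) = edge e
    edge⁺ (bwd e) = let u , v , u∈ , v∈ , u~v = edge e in v , u , v∈ , u∈ , ~-sym u~v
    rung-left : ∀ {i j u v} → u ∈ M (s i) → v ∈ M (ℓ j) → u ~ v → j ≡ i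
    rung-left {i} {j} {u} {v} u∈ v∈ u~v = sym (decidable-stable (i ≟ j) λ i≢j →
      rung≁left (lt i) (lt j) (toℕ≢ i≢j) (v , v∈ , subst (_~ v) (∈⁅⁆⁻ u∈) u~v))
    rung-right : ∀ {i j u v} → u ∈ M (s i) → v ∈ M (r j) → u ~ v → j ≡ i
    rung-right {i} {j} {u} {v} u∈ v∈ u~v = sym (decidable-stable (i ≟ j) λ i≢j →
      rung≁right (lt i) (lt j) (toℕ≢ i≢j) (v , v∈ , subst (_~ v) (∈⁅⁆⁻ u∈) u~v))
    edge⁻ : ∀ {u v h h′} → u ∈ M h → v ∈ M h′ → h ≢ h′ → u ~ v → SymClosure LadderEdge h h′
    edge⁻ {h = ℓ i} {ℓ j} u∈ v∈ h≢h′ u~v =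
      [ fwd ∘ ℓℓ , bwd ∘ ℓℓ ]′ (chain-edge⁻ left-chain u∈ v∈ (h≢h′ ∘ cong ℓ) u~v)
    edge⁻ {h = ℓ i} {s j} u∈ v∈ _ u~v = case rung-left v∈ u∈ (~-sym u~v) of λ { refl → fwd (ℓs i) }
    edge⁻ {h = ℓ i} {r j} u∈ v∈ _ u~v = contradiction u~v (proj₂ (apart (lt i) (lt j) u∈ v∈))
    edge⁻ {h = s i} {ℓ j} u∈ v∈ _ u~v = case rung-left u∈ v∈ u~v of λ { refl → bwd (ℓs j) }
    edge⁻ {u} {v} {s i} {s j} u∈ v∈ _ u~v = contradiction (subst₂ _~_ (∈⁅⁆⁻ u∈) (∈⁅⁆⁻ v∈) u~v) (independent (lt i) (lt j))
    edge⁻ {h = s i} {r j} u∈ v∈ _ u~v = case rung-right u∈ v∈ u~v of λ { refl → fwd (sr i) }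
    edge⁻ {h = r i} {ℓ j} u∈ v∈ _ u~v = contradiction (~-sym u~v) (proj₂ (apart (lt j) (lt i) v∈ u∈))
    edge⁻ {h = r i} {s j} u∈ v∈ _ u~v = case rung-right v∈ u∈ (~-sym u~v) of λ { refl → bwd (sr i) }
    edge⁻ {h = r i} {r j} u∈ v∈ h≢h′ u~v =
      [ fwd ∘ rr , bwd ∘ rr ]′ (chain-edge⁻ right-chain u∈ v∈ (h≢h′ ∘ cong r) u~v)

  -- Both ends are included: the union runs from `C a` to `C (a + d)`.
  block : (ℕ → Subset n) → ℕ → ℕ → Subset n
  block C a zero    = C a
  block C a (suc d) = block C a d ∪ C (suc (a + d))

  block-first : ∀ {C a} d → C a ⊆ block C a d
  block-first zero    = id
  block-first (suc d) = ∪ˡ ∘ block-first d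

  block-last : ∀ {C a} d → C (a + d) ⊆ block C a d
  block-last {C} {a} zero = subst (λ h → C h ⊆ C a) (sym (ℕ.+-identityʳ a)) id
  block-last {C} {a} (suc d) = subst (λ h → C h ⊆ block C a (suc d)) (sym (ℕ.+-suc a d)) ∪ʳ

  block⁻ : ∀ {C a} d {u} → u ∈ block C a d → ∃ λ h → a ≤ h × h ≤ a + d × u ∈ C h
  block⁻ {C} {a} zero u∈ = a , ℕ.≤-refl , ℕ.m≤m+n a 0 , u∈
  block⁻ {C} {a} (suc d) u∈ = ∪-elim
    (λ u∈ → let h , a≤h , h≤ , u∈h = block⁻ d u∈ in h , a≤h , ℕ.≤-trans h≤ (ℕ.+-monoʳ-≤ a (ℕ.n≤1+n d)) , u∈h)
    (λ u∈ → suc (a + d) , ℕ.m≤n⇒m≤1+n (ℕ.m≤m+n a d) , ℕ.≤-reflexive (sym (ℕ.+-suc a d)) , u∈) u∈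

  module _ {m : ℕ} {C : ℕ → Subset n} (chain : Chain m C) where
    open Chain chain

    block-conn : ∀ {a} d → a + d < m → Connected G (block C a d)
    block-conn {a} zero lt = conn (subst (_< m) (ℕ.+-identityʳ a) lt)
    block-conn {a} (suc d) lt = connected-∪ (block-conn d (ℕ.<-trans (ℕ.n<1+n _) lt′)) (conn lt′)
      (touch-mono (block-last d) id (touch lt′))
      where
      lt′ : suc (a + d) < m
      lt′ = subst (_< m) (ℕ.+-suc a d) lt

    reverse-chain : Chain m (λ i → C (m ∸ suc i))
    reverse-chain = record
      { conn = λ lt → conn (flip lt)
      ; touch = λ {i} lt → touch-sym (subst (λ h → Touch (C (m ∸ suc (suc i))) (C h)) (step lt)
          (touch (subst (_< m) (sym (step lt)) (flip (ℕ.<-trans (ℕ.n<1+n i) lt)))))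
      ; disjoint = λ {i} {j} lt lt′ u∈ u∈′ → disjoint (ℕ.∸-monoʳ-< (s≤s lt) lt′) (flip (ℕ.<-trans lt lt′)) u∈′ u∈
      ; far = λ {i} {j} lt lt′ → apart-sym (far
          (subst (suc (m ∸ suc j) <_) (step (ℕ.<-trans lt lt′)) (s≤s (ℕ.∸-monoʳ-< (s≤s lt) lt′)))
          (flip (ℕ.<-trans (ℕ.n<1+n i) (ℕ.<-trans lt lt′))))
      }
      where
      flip : ∀ {i} → i < m → m ∸ suc i < m
      flip {i} lt = ℕ.∸-monoʳ-< (s≤s z≤n) lt
      step : ∀ {i} → suc i < m → suc (m ∸ suc (suc i)) ≡ m ∸ suc i
      step {i} lt = sym (ℕ.+-∸-assoc 1 lt)

    module _ {k : ℕ} {f : ℕ → ℕ} (f-step : ∀ {i} → i < k → f i < f (suc i)) (f-end : f k ≤ m) where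

      width : ℕ → ℕ
      width i = f (suc i) ∸ suc (f i)

      -- Joins the sets from position `f i` up to, but excluding, `f (suc i)`; as blocks include
      -- both ends, `width` subtracts one more.
      coarse : ℕ → Subset n
      coarse i = block C (f i) (width i)

      private
        width-end : ∀ {i} → i < k → suc (f i + width i) ≡ f (suc i)
        width-end lt = ℕ.m+[n∸m]≡n (f-step lt)

        f-mono : ∀ {i j} → i ≤ j → j ≤ k → f i ≤ f j
        f-mono {i} {j} i≤j j≤k with ℕ.m≤n⇒m<n∨m≡n i≤j
        ... | inj₂ refl = ℕ.≤-refl
        f-mono {i} {suc j} i≤j j≤k | inj₁ i<j = ℕ.≤-trans (f-mono (s≤s⁻¹ i<j) (ℕ.<⇒≤ j≤k)) (ℕ.<⇒≤ (f-step j≤k))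

        end<m : ∀ {i} → i < k → f i + width i < m
        end<m lt = ℕ.≤-trans (ℕ.≤-reflexive (width-end lt)) (ℕ.≤-trans (f-mono lt ℕ.≤-refl) f-end)

      coarse⁻ : ∀ {i u} → i < k → u ∈ coarse i → ∃ λ h → f i ≤ h × h < f (suc i) × h < m × u ∈ C h
      coarse⁻ {i} lt u∈ = let h , f≤h , h≤ , u∈h = block⁻ (width i) u∈ in
        h , f≤h , ℕ.≤-trans (s≤s h≤) (ℕ.≤-reflexive (width-end lt)) , ℕ.≤-<-trans h≤ (end<m lt) , u∈h

      coarse-index : ∀ {i j h} → i < k → j < k → f i ≤ h → h < f (suc i) → i ≢ j → h ≢ f j
      coarse-index {i} {j} i<k j<k f≤h h< i≢j refl with ℕ.<-cmp i j
      ... | tri< i<j _ _ = ℕ.<-irrefl refl (ℕ.<-≤-trans h< (f-mono i<j (ℕ.<⇒≤ j<k)))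
      ... | tri≈ _ i≡j _ = i≢j i≡j
      ... | tri> _ _ j<i = ℕ.<-irrefl refl (ℕ.<-≤-trans (f-step j<k) (ℕ.≤-trans (f-mono j<i (ℕ.<⇒≤ i<k)) f≤h))

      coarse-chain : Chain k coarse
      coarse-chain = record
        { conn = λ {i} lt → block-conn (width i) (end<m lt)
        ; touch = λ {i} lt → let i<k = ℕ.<-trans (ℕ.n<1+n i) lt in
            touch-mono (block-last (width i)) (λ {u} u∈ → block-first (width (suc i)) (subst (λ h → u ∈ C h) (width-end i<k) u∈))
              (touch (subst (_< m) (sym (width-end i<k)) (ℕ.≤-<-trans (ℕ.m≤m+n _ _) (end<m lt))))
        ; disjoint = λ i<j j<k u∈ u∈′ →
            let h , _ , h< , _ , u∈h = coarse⁻ (ℕ.<-trans i<j j<k) u∈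
                h′ , ≤h′ , _ , h′<m , u∈h′ = coarse⁻ j<k u∈′
            in disjoint (ℕ.<-≤-trans h< (ℕ.≤-trans (f-mono i<j (ℕ.<⇒≤ j<k)) ≤h′)) h′<m u∈h u∈h′
        ; far = λ {i} si<j j<k u∈ v∈ →
            let si<k = ℕ.<-trans si<j j<k
                h , _ , h< , _ , u∈h = coarse⁻ (ℕ.<-trans (ℕ.n<1+n i) si<k) u∈
                h′ , ≤h′ , _ , h′<m , v∈h′ = coarse⁻ j<k v∈
            in far (ℕ.≤-<-trans h< (ℕ.<-≤-trans (f-step si<k) (ℕ.≤-trans (f-mono si<j (ℕ.<⇒≤ j<k)) ≤h′))) h′<m u∈h v∈h′
        }

  avoid-balls : ∀ {Y k T} → ¬ Dom Y k T → ∀ vs → All (_∈ Y) vs → length vs ≤ k →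
                ∃ λ x → x ∈ T × All (λ v → x ∉ ball v) vs
  avoid-balls {Y} {k} {T} large vs vs∈Y ≤k =
    decidable-stable (any? λ x → x ∈? T ×-dec All.all? (λ v → ¬? (x ∈? ball v)) vs) λ none →
      large (dom-mono ≤k id (dom-balls vs vs∈Y λ {t} t∈ →
        decidable-stable (Any.any? (λ v → t ∈? ball v) vs) λ ¬any → none (t , t∈ , All.¬Any⇒All¬ vs ¬any)))

  -- Greedy choice: each vertex avoids the balls of those chosen before. Chosen vertices lie in `Y`
  -- and number at most `k`, so their balls never exhaust a set that `k` vertices of `Y` do not
  -- dominate.
  independent-choice : ∀ {Y k} → Fin n → ∀ m {S : ℕ → Subset n} vs → All (_∈ Y) vs → length vs + m ≤ k →
    (∀ {i} → i < m → S i ⊆ Y × ¬ Dom Y k (S i)) →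
    ∃ λ (z : ℕ → Fin n) → (∀ {i} → i < m → z i ∈ S i × All (λ v → z i ∉ ball v) vs) × (∀ {i j} → i < j → j < m → ¬ z j ~ z i)
  -- `v₀` only fills the values beyond the range.
  independent-choice v₀ zero vs vs∈Y le S-good = (λ _ → v₀) , (λ ()) , λ _ ()
  independent-choice v₀ (suc m) {S} vs vs∈Y le S-good
    with avoid-balls (proj₂ (S-good (s≤s z≤n))) vs vs∈Y (ℕ.≤-trans (ℕ.m≤m+n _ _) le)
  ... | x , x∈S , x∉balls
    with independent-choice v₀ m {S ∘ suc} (x ∷ vs) (proj₁ (S-good (s≤s z≤n)) x∈S ∷ vs∈Y)
           (ℕ.≤-trans (ℕ.≤-reflexive (sym (ℕ.+-suc _ m))) le) (S-good ∘ s≤s)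
  ... | z , z-good , z-indep = x ◂ z
    , (λ { {zero} _ → x∈S , x∉balls ; {suc i} (s≤s lt) → let z∈ , avoids = z-good lt in z∈ , All.tail avoids })
    , λ { {zero} {suc j} _ (s≤s lt) z~x → All.head (proj₂ (z-good lt)) (∈ball-~ z~x)
        ; {suc i} {suc j} (s≤s lt) (s≤s lt′) → z-indep lt lt′ }

  module _ {m k : ℕ} {Y : Subset n} {C E S : ℕ → Subset n} {pos : ℕ → ℕ} (left : Chain m C) (right : Chain k E)
    (apart : ∀ {i j} → i < m → j < k → Apart (C i) (E j))
    (pos-mono : ∀ {i j} → i < j → j < k → pos i < pos j) (pos<m : ∀ {i} → i < k → pos i < m)
    (S~C : ∀ {i t} → i < k → t ∈ S i → t adj C (pos i))
    (S≁C : ∀ {i h t} → i < k → h < m → h ≢ pos i → t ∈ S i → ¬ t adj C h)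
    (S~E : ∀ {i t} → i < k → t ∈ S i → t adj E i)
    (S≁E : ∀ {i j t} → i < k → j < k → i ≢ j → t ∈ S i → ¬ t adj E j)
    (S-good : ∀ {i} → i < k → S i ⊆ Y × ¬ Dom Y k (S i)) where

    private
      -- The chosen positions, with `m` as a sentinel at `k` so that the last block runs to the end
      -- of the chain.
      cut : ℕ → ℕ
      cut i with i ℕ.<? k
      ... | yes _ = pos i
      ... | no _  = m

      cut≡pos : ∀ {i} → i < k → cut i ≡ pos i
      cut≡pos {i} lt with i ℕ.<? k
      ... | yes _ = refl
      ... | no ≮  = contradiction lt ≮

      cut-step : ∀ {i} → i < k → cut i < cut (suc i)
      cut-step {i} lt with i ℕ.<? k | suc i ℕ.<? k
      ... | yes _ | yes lt′ = pos-mono (ℕ.n<1+n i) lt′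
      ... | yes _ | no _    = pos<m lt
      ... | no ≮  | _       = contradiction lt ≮

      cut-end : cut k ≤ m
      cut-end with k ℕ.<? k
      ... | yes lt = contradiction lt (ℕ.<-irrefl refl)
      ... | no _   = ℕ.≤-refl

    -- Merging the left sets from one chosen position to the next leaves one left set per rung. The
    -- sets at other positions bring no new attachments to the parts `S i`, from which the rungs are
    -- chosen independently.
    chains⇒ladder : Fin n → Ladder k
    chains⇒ladder v₀ with independent-choice v₀ k {S} [] [] ℕ.≤-refl S-good
    ... | z , z-good , z-indep = record
      { left = coarse left cut-step cut-end ; right = E ; rung = z
      ; left-chain = coarse-chain left cut-step cut-end ; right-chain = right
      ; apart = λ i<k j<k u∈ → let h , _ , _ , h<m , u∈h = coarse⁻ left cut-step cut-end i<k u∈ in apart h<m j<k u∈h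
      ; rung~left = λ {i} i<k → adj-mono (block-first (width left cut-step cut-end i))
          (subst (λ h → z i adj C h) (sym (cut≡pos i<k)) (S~C i<k (z∈ i<k)))
      ; rung≁left = λ {i} {j} i<k j<k i≢j (u , u∈ , z~u) →
          let h , ≤h , h< , h<m , u∈h = coarse⁻ left cut-step cut-end j<k u∈ in
          S≁C i<k h<m (λ h≡ → coarse-index left cut-step cut-end j<k i<k ≤h h< (i≢j ∘ sym)
            (trans h≡ (sym (cut≡pos i<k)))) (z∈ i<k) (u , u∈h , z~u)
      ; rung~right = λ i<k → S~E i<k (z∈ i<k)
      ; rung≁right = λ i<k j<k i≢j → S≁E i<k j<k i≢j (z∈ i<k)
      ; independent = indep
      }
      where
      z∈ : ∀ {i} → i < k → z i ∈ S i
      z∈ lt = proj₁ (z-good lt)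
      indep : ∀ {i j} → i < k → j < k → ¬ z i ~ z j
      indep {i} {j} i<k j<k zi~zj with ℕ.<-cmp i j
      ... | tri< i<j _ _  = z-indep i<j j<k (~-sym zi~zj)
      ... | tri≈ _ refl _ = ~-irrefl refl zi~zj
      ... | tri> _ _ j<i  = z-indep j<i i<k zi~zj

  path-chain : ∀ {_⊏_ Y f q L v T js} (path : PathModel _⊏_ Y f q L v T js) → Chain q (PathModel.C path)
  path-chain path = record { conn = conn ; touch = touch ; disjoint = disjoint ; far = far }
    where open PathModel path

  -- A ladder from a path in `L` and a path in `R`.

  module _ {_⊏_ : ℕ → ℕ → Set} {f m k : ℕ} {Y L R : Subset n} {v v′ : Fin n} {js : List ℕ} {T : ℕ → Subset n}
    (L-apart : Apart L R) (T⊆Y : ∀ {j} → j ∈ˡ js → T j ⊆ Y) (P : PathModel _⊏_ Y f m L v T js) where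
    private module P = PathModel P

    module _ {_⊏′_ : ℕ → ℕ → Set} (Q : PathModel _⊏′_ Y k k R v′ P.S (List.upTo m)) where
      private
        module Q = PathModel Q

        tag<m : ∀ {i} → i < k → Q.tag i < m
        tag<m lt = Mem.∈-upTo⁻ (Q.tag∈ lt)

        good : ∀ {i} → i < k → Q.S i ⊆ Y × ¬ Dom Y k (Q.S i)
        good lt = T⊆Y (P.tag∈ (tag<m lt)) ∘ P.S⊆T (tag<m lt) ∘ Q.S⊆T lt , Q.large lt

      -- The parts of `Q` are taken from those of `P`, and its tags are their positions along `P`.
      increasing-ladder : (∀ {i j} → i < j → j < k → Q.tag i < Q.tag j) → Ladder k
      increasing-ladder mono = chains⇒ladder (path-chain P) (path-chain Q)
        (λ i<m j<k → apart-mono (P.C⊆L i<m) (Q.C⊆L j<k) L-apart) mono tag<m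
        (λ lt t∈ → P.S~C (tag<m lt) (Q.S⊆T lt t∈))
        (λ lt h<m h≢ t∈ → P.S≁C (tag<m lt) h<m (h≢ ∘ sym) (Q.S⊆T lt t∈))
        Q.S~C Q.S≁C good v

      -- Reversing the left chain turns decreasing positions into increasing ones.
      decreasing-ladder : (∀ {i j} → i < j → j < k → Q.tag i > Q.tag j) → Ladder k
      decreasing-ladder mono = chains⇒ladder (reverse-chain (path-chain P)) (path-chain Q)
        (λ i<m j<k → apart-mono (P.C⊆L (flip i<m)) (Q.C⊆L j<k) L-apart)
        (λ i<j j<k → ℕ.∸-monoʳ-< (s≤s (mono i<j j<k)) (tag<m (ℕ.<-trans i<j j<k)))
        (flip ∘ tag<m)
        (λ lt t∈ → subst (λ h → _ adj P.C h) (sym (flip-flip (tag<m lt))) (P.S~C (tag<m lt) (Q.S⊆T lt t∈)))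
        (λ lt h<m h≢ t∈ → P.S≁C (tag<m lt) (flip h<m)
          (λ tag≡ → h≢ (trans (sym (flip-flip h<m)) (cong (λ h → m ∸ suc h) (sym tag≡)))) (Q.S⊆T lt t∈))
        Q.S~C Q.S≁C good v
        where
        flip : ∀ {i} → i < m → m ∸ suc i < m
        flip lt = ℕ.∸-monoʳ-< (s≤s z≤n) lt
        flip-flip : ∀ {i} → i < m → m ∸ suc (m ∸ suc i) ≡ i
        flip-flip {i} lt = trans (cong (m ∸_) (sym (ℕ.+-∸-assoc 1 lt))) (ℕ.m∸[m∸n]≡n (ℕ.<⇒≤ lt))

  -- Bounded domination of a set attached to two sides.

  AttachedPart : (Y R T A : Subset n) → Set
  AttachedPart Y R T A = Connected G A × A ⊆ Y × Apart A R × T ⊆ nb A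

  -- With C ⊆ R attached to a large part of T but not to a ∈ T, every c in that part has a common
  -- neighbour with a in some member of As: otherwise the members of As, joined to a and c, give
  -- a creature.  Then the common neighbours, a and C give one.
  crossing-bound : ∀ {k} → CreatureFree G k → ∀ {Y R T As} → Connected G R → R ⊆ Y → T ⊆ Y → T ⊆ nb R →
    (∀ {t} → t ∈ T → t ∉ R) → All (AttachedPart Y R T) As → AllPairs Apart As → k ≤ length As →
    Dom Y (2 + k) T
  crossing-bound {k} free {Y} {R} {T} {As} conn-R@((v , v∈R) , _) R⊆Y T⊆Y T⊆R T∉R parts pairwise k≤ =
    decidable-stable (dom? Y (2 + k) T) λ big →
      contradict big (growth {T = λ _ → T} {js = 0 ∷ []} conn-R v∈R R⊆Y
        (0 , here refl , big ∘ dom-mono (ℕ.n≤1+n _) (λ t∈ → ∩⁺ t∈ (T⊆R t∈))))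
    where
    contradict : ¬ Dom Y (2 + k) T → ¬ Growth Y R v (suc k) (λ _ → T) (0 ∷ [])
    -- The ball of `a` and `k` common neighbours would dominate a part that `suc k` vertices do not
    -- dominate.
    contradict big growth = large (dom-∪ (dom-ball {T = ball a} (T⊆Y a∈T) id)
      (cover-by-vertices free (connected-⁅⁆ a) conn-C (apart-⁅⁆ (T∉R a∈T ∘ C⊆L) a≁C)
        U-apart U⊆Y (adj⁅⁆⁺ ∘ proj₁ ∘ U⁻)
        (λ t∈ → ∈nb⁻ (proj₂ (∩⁻ (proj₁ (∖⁻ t∈)))) , proj₂ (∖⁻ t∈) ∘ ∈ball-~ ∘ adj⁅⁆⁻)
        T₁⊆U) split)
      where
      open Growth growth
      remainder : ∃ λ a → a ∈ T ∖ nb C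
      -- The part of `T` at `C` is dominated by `2 + k` vertices while `T` is not, so some `a` in
      -- `T` is not attached to `C`.
      remainder = ¬dom⇒nonempty {Y} {0} λ none → big (dom-mono ℕ.≤-refl (λ {t} t∈ →
        ∩⁺ t∈ (decidable-stable (t ∈? nb C) λ t∉ → none (t , ∖⁺ t∈ t∉))) (bounded (here refl)))
      a : Fin n
      a = proj₁ remainder
      a∈T : a ∈ T
      a∈T = proj₁ (∖⁻ (proj₂ remainder))
      a≁C : ¬ a adj C
      a≁C = proj₂ (∖⁻ (proj₂ remainder)) ∘ ∈nb⁺
      U? : Decidable (λ u → u ~ a × Any (u ∈_) As)
      U? u = u ~? a ×-dec Any.any? (u ∈?_) As
      U T₁ : Subset n
      U = ⟪ U? ⟫
      T₁ = (T ∩ nb C) ∖ ball a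
      U⁻ : ∀ {u} → u ∈ U → u ~ a × Any (u ∈_) As
      U⁻ = ∈⟪⟫⁻ U?
      U-apart : Apart U C
      U-apart u∈ v∈ = let A , A∈ , u∈A = find (proj₂ (U⁻ u∈)) ; _ , _ , A-apart , _ = All.lookup parts A∈ in
        A-apart u∈A (C⊆L v∈)
      U⊆Y : U ⊆ Y
      U⊆Y u∈ = let A , A∈ , u∈A = find (proj₂ (U⁻ u∈)) ; _ , A⊆Y , _ = All.lookup parts A∈ in A⊆Y u∈A
      split : T ∩ nb C ⊆ ball a ∪ T₁
      split {t} t∈ with t ∈? ball a
      ... | yes p = ∪ˡ p
      ... | no ¬p = ∪ʳ (∖⁺ t∈ ¬p)
      T₁⊆U : T₁ ⊆ nb U
      T₁⊆U {c} c∈ = decidable-stable (c ∈? nb U) λ c∉ → free (broom⇒creature (broom (c∉ ∘ ∈nb⁺)))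
        where
        c∈T : c ∈ T
        c∈T = proj₁ (∩⁻ (proj₁ (∖⁻ c∈)))
        at : Fin k → Fin (length As)
        at i = Fin.inject≤ i k≤
        A : Fin k → Subset n
        A i = List.lookup As (at i)
        A∈ : ∀ i → A i ∈ˡ As
        A∈ i = Mem.∈-lookup (at i)
        part : ∀ i → AttachedPart Y R T (A i)
        part i = All.lookup parts (A∈ i)
        A-apart : ∀ {i j} → i ≢ j → Apart (A i) (A j)
        A-apart i≢j = lookup-pairs {R = Apart} (λ ap → apart-sym ap) pairwise (i≢j ∘ Fin.inject≤-injective k≤ k≤ _ _)
        module _ (c≁U : ¬ c adj U) where
          no-common : ∀ {i u} → u ∈ A i → u ~ a → ¬ c ~ u
          no-common {i} {u} u∈A u~a c~u =
            c≁U (u , ∈⟪⟫⁺ U? (u~a , Any.map (λ A≡ → subst (u ∈_) A≡ u∈A) (A∈ i)) , c~u)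
          a-nbr : ∀ i → a adj A i
          a-nbr i = ∈nb⁻ (proj₂ (proj₂ (proj₂ (part i))) a∈T)
          c-nbr : ∀ i → c adj A i
          c-nbr i = ∈nb⁻ (proj₂ (proj₂ (proj₂ (part i))) c∈T)
          -- Within `A i`, a connected set is grown from a neighbour of `a` up to the first
          -- neighbour of `c`; the latter is the `z i` of the broom.
          pushed : ∀ i → Pushed (A i) ⁅ proj₁ (a-nbr i) ⁆ (c ~_)
          pushed i =
            let u , u∈A , a~u = a-nbr i
                u′ , u′∈A , c~u′ = c-nbr i
            in push (c ~?_) (proj₁ (part i)) (connected-⁅⁆ u) (⁅⁆⊆ u∈A)
                 (⁅⁆-elim (λ v → ¬ c ~ v) (no-common {i} u∈A (~-sym a~u))) u′∈A c~u′
          module P i = Pushed (pushed i)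
          broom : Broom k
          broom = record
            { A = ⁅ a ⁆ ; B = ⁅ c ⁆ ; D = P.Q ; z = P.x
            ; conn-A = connected-⁅⁆ a ; conn-B = connected-⁅⁆ c ; conn-D = P.connected
            ; touch = λ i → let u , _ , a~u = a-nbr i in a , u , x∈⁅x⁆ a , P.Q₀⊆Q i (x∈⁅x⁆ u) , inj₂ a~u
            ; A-apart = apart-⁅⁆ (λ a∈ → proj₂ (∖⁻ c∈) (subst (_∈ ball a) (∈⁅⁆⁻ a∈) ∈ball-≡))
                (proj₂ (∖⁻ c∈) ∘ ∈ball-~ ∘ ~-sym ∘ adj⁅⁆⁻)
            ; D-apart = λ i → apart-sym (apart-⁅⁆
                (λ c∈Q → apart⇒¬adj (proj₁ (proj₂ (proj₂ (part i)))) (P.Q⊆X i c∈Q) (∈nb⁻ (T⊆R c∈T)))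
                (λ (u , u∈ , c~u) → P.¬P i u∈ c~u))
            ; z~D = P.x~Q
            ; z≁D = λ {i} {j} i≢j → apart⇒¬adj (apart-mono id (P.Q⊆X j) (A-apart i≢j)) (P.x∈X i)
            ; z≁A = λ i x~a → no-common {i} (P.x∈X i) (adj⁅⁆⁻ x~a) (P.Px i)
            ; z~B = λ i → adj⁅⁆⁺ (~-sym (P.Px i))
            }

  -- d bounds the number of further crossings: each of them adds a set to 𝒜.
  module _ {k : ℕ} (free : CreatureFree G k) (no-ladder : ¬ Ladder k) where

    dominated : ∀ d {Y L R T 𝒜} → Connected G L → Connected G R → L ⊆ Y → R ⊆ Y → T ⊆ Y → Apart L R →
      T ⊆ nb L → T ⊆ nb R → All (λ A → Apart A L × AttachedPart Y R T A) 𝒜 → AllPairs Apart 𝒜 →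
      k ≤ suc (length 𝒜) + d → Dom Y (dominationBound k d) T
    dominated zero {𝒜 = 𝒜} conn-L conn-R L⊆Y R⊆Y T⊆Y L-apart T⊆L T⊆R parts pairwise k≤ =
      -- With no crossings left to allow, `L` and `𝒜` together are at least `k` pairwise apart sets
      -- attached to all of `T`.
      crossing-bound free conn-R R⊆Y T⊆Y T⊆R
        (λ t∈ t∈R → apart⇒¬adj (apart-sym L-apart) t∈R (∈nb⁻ (T⊆L t∈)))
        ((conn-L , L⊆Y , L-apart , T⊆L) ∷ All.map proj₂ parts)
        (All.map (apart-sym ∘ proj₁) parts ∷ pairwise) (subst (k ≤_) (ℕ.+-identityʳ _) k≤)
    dominated (suc d) {Y} {L} {R} {T} {𝒜} conn-L@((v , v∈L) , _) conn-R@((v′ , v′∈R) , _)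
              L⊆Y R⊆Y T⊆Y L-apart T⊆L T⊆R parts pairwise k≤ =
      decidable-stable (dom? Y _ T) λ big →
        [ crossing-L , [ on-path , on-path ]′ ]′
          -- In `L` every index carries the same set `T`, and a path in either order serves.
          (path-or-crossing free conn-R g f q q {T = λ _ → T} {js = List.upTo (indexThreshold k q q)} conn-L v∈L L⊆Y L-apart
            (λ _ → T⊆L , T⊆R , big) (Unique.upTo⁺ _) (ℕ.≤-reflexive (sym (List.length-upTo _))))
      where
      q g f : ℕ
      q = indexThreshold k k k
      g = dominationBound k d
      f = sizeThreshold k g k k k
      k≤′ : k ≤ suc (suc (length 𝒜)) + d
      k≤′ = subst (k ≤_) (cong suc (ℕ.+-suc (length 𝒜) d)) k≤
      crossing-L : ∀ {js} → ¬ Crossing Y L g (λ _ → T) js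
      -- `X.C` replaces `L` and `X.D` joins `𝒜`; the new, smaller target is attached to both.
      crossing-L crossing = X.large (dominated d X.conn-C conn-R (L⊆Y ∘ X.C⊆L) R⊆Y (T⊆Y ∘ sub)
        (apart-mono X.C⊆L id L-apart) (proj₁ ∘ ∩⁻ ∘ proj₂ ∘ ∩⁻) (T⊆R ∘ sub)
        ((apart-sym X.C-apart , X.conn-D , L⊆Y ∘ X.D⊆L , apart-mono X.D⊆L id L-apart , proj₂ ∘ ∩⁻ ∘ proj₂ ∘ ∩⁻)
          ∷ All.map restrict parts)
        (All.map D-apart parts ∷ pairwise) k≤′)
        where
        module X = Crossing crossing
        sub : T ∩ (nb X.C ∩ nb X.D) ⊆ T
        sub = proj₁ ∘ ∩⁻
        restrict : ∀ {A} → Apart A L × AttachedPart Y R T A → Apart A X.C × AttachedPart Y R (T ∩ (nb X.C ∩ nb X.D)) A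
        restrict (A-L , conn-A , A⊆Y , A-R , T⊆A) = apart-mono id X.C⊆L A-L , conn-A , A⊆Y , A-R , T⊆A ∘ sub
        D-apart : ∀ {A} → Apart A L × AttachedPart Y R T A → Apart X.D A
        D-apart (A-L , _) = apart-mono X.D⊆L id (apart-sym A-L)
      on-path : ∀ {_⊏_ js} → ¬ PathModel _⊏_ Y f q L v (λ _ → T) js
      on-path path =
        [ crossing-R , [ (λ path′ → no-ladder (increasing-ladder L-apart (λ _ → T⊆Y) path path′ (PathModel.tag-mono path′)))
                       , (λ path′ → no-ladder (decreasing-ladder L-apart (λ _ → T⊆Y) path path′ (PathModel.tag-mono path′))) ]′ ]′
          -- In `R` the targets are the parts of the first path, indexed by position. Parts not
          -- dominated by `k` vertices leave room for `k` independent rungs.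
          (path-or-crossing free conn-L g k k k {js = List.upTo q} conn-R v′∈R R⊆Y (apart-sym L-apart)
            (λ j∈ → let j<q = Mem.∈-upTo⁻ j∈ in T⊆R ∘ P.S⊆T j<q , T⊆L ∘ P.S⊆T j<q , P.large j<q)
            (Unique.upTo⁺ q) (ℕ.≤-reflexive (sym (List.length-upTo q))))
        where
        module P = PathModel path
        crossing-R : ¬ Crossing Y R g P.S (List.upTo q)
        -- `X.C` replaces `R`; `X.D` joins `𝒜`, being part of `R` and hence apart from `L` and from
        -- the earlier members.
        crossing-R crossing = X.large (dominated d conn-L X.conn-C L⊆Y (R⊆Y ∘ X.C⊆L) (T⊆Y ∘ sub)
          (apart-mono id X.C⊆L L-apart) (T⊆L ∘ sub) (proj₁ ∘ ∩⁻ ∘ proj₂ ∘ ∩⁻)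
          ((apart-mono X.D⊆L id (apart-sym L-apart) , X.conn-D , R⊆Y ∘ X.D⊆L , apart-sym X.C-apart , proj₂ ∘ ∩⁻ ∘ proj₂ ∘ ∩⁻)
            ∷ All.map restrict parts)
          (All.map D-apart parts ∷ pairwise) k≤′)
          where
          module X = Crossing crossing
          sub : P.S X.j ∩ (nb X.C ∩ nb X.D) ⊆ T
          sub = P.S⊆T (Mem.∈-upTo⁻ X.j∈js) ∘ proj₁ ∘ ∩⁻
          restrict : ∀ {A} → Apart A L × AttachedPart Y R T A →
                     Apart A L × AttachedPart Y X.C (P.S X.j ∩ (nb X.C ∩ nb X.D)) A
          restrict (A-L , conn-A , A⊆Y , A-R , T⊆A) = A-L , conn-A , A⊆Y , apart-mono id X.C⊆L A-R , T⊆A ∘ sub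
          D-apart : ∀ {A} → Apart A L × AttachedPart Y R T A → Apart X.D A
          D-apart (_ , _ , _ , A-R , _) = apart-mono X.D⊆L id (apart-sym A-R)

  -- Traces of minimal separators

  -- Open neighbourhoods, in contrast to the closed balls of `Dom`: a covering vertex must be
  -- adjacent to what it covers, as in a trace.
  Covered : Subset n → ℕ → Subset n → Set
  Covered X b T = ∃ λ vs → length vs ≤ b × All (_∈ X) vs × (∀ {t} → t ∈ T → Any (t ~_) vs)

  -- Each dominator is replaced by at most `b` vertices of `X` covering its ball.
  dom⇒covered : ∀ {X Y b T₀} → (∀ {v} → v ∈ Y → Covered X b (T₀ ∩ ball v)) →
                ∀ m {T} → T ⊆ T₀ → Dom Y m T → Covered X (m * b) T
  dom⇒covered cover-ball zero sub e = [] , z≤n , [] , λ t∈ → contradiction (_ , t∈) e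
  dom⇒covered cover-ball (suc m) sub (inj₁ e) = [] , z≤n , [] , λ t∈ → contradiction (_ , t∈) e
  dom⇒covered {X} {Y} {b} {T₀} cover-ball (suc m) {T} sub (inj₂ (v , v∈Y , d))
    with cover-ball v∈Y | dom⇒covered cover-ball m (sub ∘ proj₁ ∘ ∖⁻) d
  ... | us , us≤ , us∈X , us-cover | vs , vs≤ , vs∈X , vs-cover =
    us ++ vs , ℕ.≤-trans (ℕ.≤-reflexive (List.length-++ us)) (ℕ.+-mono-≤ us≤ vs≤) , All.++⁺ us∈X vs∈X , both
    where
    both : ∀ {t} → t ∈ T → Any (t ~_) (us ++ vs)
    both {t} t∈ with t ∈? ball v
    ... | yes p = Any.++⁺ˡ (us-cover (∩⁺ (sub t∈) p))
    ... | no ¬p = Any.++⁺ʳ us (vs-cover (∖⁺ t∈ ¬p))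

  Clique : ℕ → Subset n → Set
  Clique j T = ∃ λ xs → length xs ≡ j × All (_∈ T) xs × AllPairs _~_ xs

  -- A dominating vertex in T dominates a part of T with a smaller clique number.
  clique-free⇒covered : ∀ {k} → CreatureFree G k → ¬ Ladder k → ∀ {L R} → Connected G L → Connected G R → Apart L R →
    ∀ j {T} → T ⊆ nb L → T ⊆ nb R → ¬ Clique j T → Covered (L ∪ R) (coverBound k j) T
  clique-free⇒covered free no-ladder conn-L conn-R L-apart zero _ _ no-clique =
    contradiction ([] , refl , [] , []) no-clique
  clique-free⇒covered {k} free no-ladder {L} {R} conn-L conn-R L-apart (suc j) {T} T⊆L T⊆R no-clique =
    dom⇒covered cover-ball (dominationBound k k) id
      (dominated free no-ladder k {Y = (L ∪ R) ∪ T} {𝒜 = []} conn-L conn-R (∪ˡ ∘ ∪ˡ) (∪ˡ ∘ ∪ʳ) ∪ʳ L-apart T⊆L T⊆R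
        [] [] (ℕ.n≤1+n k))
    where
    T∉L∪R : ∀ {t} → t ∈ T → t ∉ L ∪ R
    T∉L∪R t∈ = ∪-elim (λ t∈L → apart⇒¬adj L-apart t∈L (∈nb⁻ (T⊆R t∈)))
                      (λ t∈R → apart⇒¬adj (apart-sym L-apart) t∈R (∈nb⁻ (T⊆L t∈)))
    cover-outside : ∀ {v} → v ∈ L ∪ R → Covered (L ∪ R) (suc (coverBound k j)) (T ∩ ball v)
    cover-outside {v} v∈ = v ∷ [] , s≤s z≤n , v∈ ∷ [] , λ t∈ → let t∈T , t∈ball = ∩⁻ t∈ in
      [ (λ t≡v → contradiction v∈ (T∉L∪R (subst (_∈ T) t≡v t∈T))) , here ]′ (∈ball⁻ t∈ball)
    -- A neighbour `l` in `L` covers `v` itself; the neighbours of `v` in `T` contain no clique of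
    -- size `j`, so induction covers them.
    cover-inside : ∀ {v} → v ∈ T → Covered (L ∪ R) (suc (coverBound k j)) (T ∩ ball v)
    cover-inside {v} v∈T
      with ∈nb⁻ (T⊆L v∈T) | clique-free⇒covered free no-ladder conn-L conn-R L-apart j {T ∩ nb ⁅ v ⁆}
                              (T⊆L ∘ proj₁ ∘ ∩⁻) (T⊆R ∘ proj₁ ∘ ∩⁻) smaller
      where
      smaller : ¬ Clique j (T ∩ nb ⁅ v ⁆)
      smaller (xs , xs-length , xs∈ , xs-clique) = no-clique
        ( v ∷ xs , cong suc xs-length , v∈T ∷ All.map (proj₁ ∘ ∩⁻) xs∈
        , All.map (λ x∈ → ~-sym (adj⁅⁆⁻ (∈nb⁻ (proj₂ (∩⁻ x∈))))) xs∈ ∷ xs-clique )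
    ... | l , l∈L , v~l | vs , vs≤ , vs∈ , vs-cover = l ∷ vs , s≤s vs≤ , ∪ˡ l∈L ∷ vs∈ , λ t∈ →
      let t∈T , t∈ball = ∩⁻ t∈ in
      [ (λ t≡v → here (subst (_~ l) (sym t≡v) v~l))
      , (λ t~v → there (vs-cover (∩⁺ t∈T (∈nb⁺ (adj⁅⁆⁺ t~v))))) ]′ (∈ball⁻ t∈ball)
    cover-ball : ∀ {v} → v ∈ (L ∪ R) ∪ T → Covered (L ∪ R) (suc (coverBound k j)) (T ∩ ball v)
    cover-ball v∈ = ∪-elim cover-outside cover-inside v∈

  clique⇒subset : ∀ {S j} → Clique j S → ∃ λ K → K ⊆ S × ∣ K ∣ ≡ j × IsClique G K
  clique⇒subset {S} (xs , refl , xs∈S , clique) = K xs , K⊆S , card clique , λ u∈ v∈ → K-clique clique (K⁻ xs u∈) (K⁻ xs v∈)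
    where
    K : List (Fin n) → Subset n
    K = ⋃ ∘ map ⁅_⁆
    K⁻ : ∀ xs {x} → x ∈ K xs → x ∈ˡ xs
    K⁻ xs x∈ = Any.map ∈⁅⁆⁻ (Any.map⁻ (∈-⋃⁻ (map ⁅_⁆ xs) x∈))
    K⊆S : K xs ⊆ S
    K⊆S x∈ = All.lookup xs∈S (K⁻ xs x∈)
    K-clique : ∀ {xs u v} → AllPairs _~_ xs → u ∈ˡ xs → v ∈ˡ xs → u ≢ v → u ~ v
    K-clique _ (here refl) (here refl) u≢v = contradiction refl u≢v
    K-clique (u~ ∷ _) (here refl) (there v∈) _ = All.lookup u~ v∈
    K-clique (v~ ∷ _) (there u∈) (here refl) _ = ~-sym (All.lookup v~ u∈)
    K-clique (_ ∷ pairs) (there u∈) (there v∈) u≢v = K-clique pairs u∈ v∈ u≢v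
    card : ∀ {xs} → AllPairs _~_ xs → ∣ K xs ∣ ≡ length xs
    card [] = ∣⊥∣≡0 n
    card {x ∷ xs} (x~ ∷ pairs) = trans (∣⁅x⁆∪p∣ x (K xs) λ x∈ → ~-irrefl refl (All.lookup x~ (K⁻ xs x∈)))
                                       (cong suc (card pairs))

  record Sides (S : Subset n) : Set where
    field
      L R     : Subset n
      conn-L  : Connected G L
      conn-R  : Connected G R
      L-apart : Apart L R
      S~L     : ∀ {t} → t ∈ S → t adj L
      S~R     : ∀ {t} → t ∈ S → t adj R
      ~R⇒∈S   : ∀ {t} → t adj R → t ∉ R → t ∈ S
      ~L⇒∈S   : ∀ {t} → t adj L → t ∉ L → t ∈ S

  flip-sides : ∀ {S} → Sides S → Sides S
  flip-sides sides = record
    { L = R ; R = L ; conn-L = conn-R ; conn-R = conn-L ; L-apart = apart-sym L-apart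
    ; S~L = S~R ; S~R = S~L ; ~R⇒∈S = ~L⇒∈S ; ~L⇒∈S = ~R⇒∈S }
    where open Sides sides

  -- Two touching components have a connected union and coincide by maximality, so distinct ones are
  -- apart.
  minimal-separator-sides : ∀ {S} → IsMinimalSeparator G S → Sides S
  minimal-separator-sides {S} separator = record
    { L = L ; R = R ; conn-L = L.connected ; conn-R = R.connected
    ; L-apart = λ u∈L v∈R → (λ { refl → no-touch (_ , _ , u∈L , v∈R , inj₁ refl) })
                          , (λ u~v → no-touch (_ , _ , u∈L , v∈R , inj₂ u~v))
    ; S~L = λ t∈S → let _ , u , u∈L , u~t = proj₂ N[L]≐S t∈S in u , u∈L , ~-sym u~t
    ; S~R = λ t∈S → let _ , u , u∈R , u~t = proj₂ N[R]≐S t∈S in u , u∈R , ~-sym u~t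
    ; ~L⇒∈S = λ (u , u∈L , t~u) t∉L → proj₁ N[L]≐S (t∉L , u , u∈L , ~-sym t~u)
    ; ~R⇒∈S = λ (u , u∈R , t~u) t∉R → proj₁ N[R]≐S (t∉R , u , u∈R , ~-sym t~u) }
    where
    open IsMinimalSeparator separator
    module L = IsComponent L-component
    module R = IsComponent R-component
    no-touch : ¬ Touch L R
    no-touch touch = L≢R (⊆-antisym
      (λ x∈ → R.maximal ∪ʳ L∪R⊆∁S connected (∪ˡ x∈)) (λ x∈ → L.maximal ∪ˡ L∪R⊆∁S connected (∪ʳ x∈)))
      where
      connected : Connected G (L ∪ R)
      connected = connected-∪ L.connected R.connected touch
      L∪R⊆∁S : L ∪ R ⊆ ∁ S
      L∪R⊆∁S = ∪-lub L.C⊆X R.C⊆X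

  OrientedSeparator : Set
  OrientedSeparator = ∃ Sides

  module _ (os : List OrientedSeparator) (x y : Fin n) where

    Separates : OrientedSeparator → Set
    Separates (_ , sides) = x ∈ Sides.L sides × y ∈ Sides.R sides

    separates? : Decidable Separates
    separates? (_ , sides) = x ∈? Sides.L sides ×-dec y ∈? Sides.R sides

    trace : OrientedSeparator → Subset n
    trace (S , _) = S ∩ nb ⁅ x ⁆

    traces : List (Subset n)
    traces = List.deduplicate _≟ˢ_ (map trace (filter separates? os))

    traces⁺ : ∀ {o} → o ∈ˡ os → Separates o → trace o ∈ˡ traces
    traces⁺ o∈ sep = Mem.∈-deduplicate⁺ _≟ˢ_ (Mem.∈-map⁺ trace (Mem.∈-filter⁺ separates? o∈ sep))

    traces⁻ : ∀ {W} → W ∈ˡ traces → ∃ λ o → Separates o × W ≡ trace o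
    traces⁻ W∈ =
      let o , o∈ , W≡ = Mem.∈-map⁻ trace (Mem.∈-deduplicate⁻ _≟ˢ_ (map trace (filter separates? os)) W∈)
      in o , proj₂ (Mem.∈-filter⁻ separates? {xs = os} o∈) , W≡

    -- If z i lies in W j only for i = j, then z i has a neighbour in the y-side of the separator of
    -- W i, but in no other y-side; these sides all contain y, and x is adjacent to every z i.
    length-traces : ∀ {k} → CreatureFree G k → length traces ≤ suc n ^ k
    length-traces {k} free = ℕ.≮⇒≥ λ long →
      free (broom⇒creature (broom (dispersed k traces (DecUnique.deduplicate-! _≟ˢ_ _) long)))
      where
      broom : Dispersed k traces → Broom k
      broom δ = record
        -- No `z i` lies in `W₀`, so none is attached to the `y`-side of its separator, which is
        -- therefore the handle.
        { A = Sides.R (proj₂ o₀) ; B = ⁅ x ⁆ ; D = λ i → Sides.R (proj₂ (o i)) ; z = z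
        ; conn-A = Sides.conn-R (proj₂ o₀) ; conn-B = connected-⁅⁆ x ; conn-D = λ i → Sides.conn-R (proj₂ (o i))
        ; touch = λ i → y , y , proj₂ (sep W₀∈𝓕) , proj₂ (sep (W∈𝓕 i)) , inj₁ refl
        ; A-apart = R-apart W₀∈𝓕 ; D-apart = λ i → R-apart (W∈𝓕 i)
        ; z~D = λ i → Sides.S~R (proj₂ (o i)) (proj₁ (∩⁻ (subst (z i ∈_) (W≡ (W∈𝓕 i)) (z∈W i))))
        ; z≁D = λ {i} {j} i≢j → nonadjacent i (W∈𝓕 j) (z∉W i≢j)
        ; z≁A = λ i → nonadjacent i W₀∈𝓕 (z∉W₀ i)
        ; z~B = λ i → adj⁅⁆⁺ (z~x i) }
        where
        open Dispersed δ
        origin : ∀ {W} → W ∈ˡ traces → OrientedSeparator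
        origin W∈ = proj₁ (traces⁻ W∈)
        sep : ∀ {W} (W∈ : W ∈ˡ traces) → Separates (origin W∈)
        sep W∈ = proj₁ (proj₂ (traces⁻ W∈))
        W≡ : ∀ {W} (W∈ : W ∈ˡ traces) → W ≡ trace (origin W∈)
        W≡ W∈ = proj₂ (proj₂ (traces⁻ W∈))
        o₀ : OrientedSeparator
        o₀ = origin W₀∈𝓕
        o : Fin k → OrientedSeparator
        o i = origin (W∈𝓕 i)
        R-apart : ∀ {W} (W∈ : W ∈ˡ traces) → Apart (Sides.R (proj₂ (origin W∈))) ⁅ x ⁆
        R-apart W∈ = apart-mono id (⁅⁆⊆ (proj₁ (sep W∈))) (apart-sym (Sides.L-apart (proj₂ (origin W∈))))
        z~x : ∀ i → z i ~ x
        z~x i = adj⁅⁆⁻ (∈nb⁻ (proj₂ (∩⁻ (subst (z i ∈_) (W≡ (W∈𝓕 i)) (z∈W i)))))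
        nonadjacent : ∀ i {W} (W∈ : W ∈ˡ traces) → z i ∉ W → ¬ z i adj Sides.R (proj₂ (origin W∈))
        -- A vertex attached to the `y`-side lies in that side or in the separator. Being adjacent
        -- to `x`, `z i` cannot lie in the side, so it would lie in the trace.
        nonadjacent i W∈ z∉W z~R = z∉W (subst (z i ∈_) (sym (W≡ W∈))
          (∩⁺ (Sides.~R⇒∈S (proj₂ (origin W∈)) z~R
                (λ z∈R → proj₂ (R-apart W∈ z∈R (x∈⁅x⁆ x)) (z~x i)))
              (∈nb⁺ (adj⁅⁆⁺ (z~x i)))))

  -- Both orientations are listed, so that a covering vertex in `R` also occurs as the `x` of a
  -- trace.
  oriented : ∀ {Ss} → All (IsMinimalSeparator G) Ss → List OrientedSeparator
  oriented [] = []
  oriented (separator ∷ separators) = let sides = minimal-separator-sides separator in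
    (_ , sides) ∷ (_ , flip-sides sides) ∷ oriented separators

  oriented⁺ : ∀ {Ss S} (separators : All (IsMinimalSeparator G) Ss) → S ∈ˡ Ss →
              ∃ λ sides → (S , sides) ∈ˡ oriented separators × (S , flip-sides sides) ∈ˡ oriented separators
  oriented⁺ (separator ∷ separators) (here refl) = minimal-separator-sides separator , here refl , there (here refl)
  oriented⁺ (separator ∷ separators) (there S∈) = let sides , o∈ , o′∈ = oriented⁺ separators S∈ in
    sides , there (there o∈) , there (there o′∈)

  -- `⊥` is included as the padding required by `∈-unions`.
  all-traces : List OrientedSeparator → List (Subset n)
  all-traces os = ⊥ ∷ List.concatMap (λ x → List.concatMap (traces os x) (List.allFin n)) (List.allFin n)

  length-all-traces : ∀ {k} → CreatureFree G k → ∀ os → length (all-traces os) ≤ 1 + n * (n * suc n ^ k)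
  length-all-traces {k} free os = s≤s
    (over-vertices λ x → over-vertices {f = traces os x} λ y → length-traces os x y free)
    where
    over-vertices : ∀ {f : Fin n → List (Subset n)} {m} → (∀ x → length (f x) ≤ m) →
                    length (List.concatMap f (List.allFin n)) ≤ n * m
    over-vertices {f} {m} bound = subst (λ l → length (List.concatMap f (List.allFin n)) ≤ l * m)
      (List.length-tabulate {n = n} id) (length-concatMap {f = f} (List.allFin n) bound)

  ∈-all-traces : ∀ {os o x y} → o ∈ˡ os → Separates os x y o → trace os x y o ∈ˡ all-traces os
  ∈-all-traces {os} {o} {x} {y} o∈ sep = there (Mem.∈-concatMap⁺ _ (Any.map
    (λ { refl → Mem.∈-concatMap⁺ _ (Any.map (λ { refl → traces⁺ os x y o∈ sep }) (Mem.∈-allFin y)) }) (Mem.∈-allFin x)))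

  module _ {k : ℕ} (free : CreatureFree G k) (no-ladder : ¬ Ladder k) (no-clique : NoSeparatorContainsClique G k) where

    -- `S` is covered by boundedly many vertices of `L ∪ R`, hence is the union of its traces at
    -- them. Any vertex of the opposite side serves as `y`.
    separator∈unions : ∀ {Ss S} (separators : All (IsMinimalSeparator G) Ss) → S ∈ˡ Ss →
                       S ∈ˡ unions (coverBound k k) (all-traces (oriented separators))
    separator∈unions {Ss} {S} separators S∈ = result
      where
      os : List OrientedSeparator
      os = oriented separators
      result : S ∈ˡ unions (coverBound k k) (all-traces os)
      result with oriented⁺ separators S∈
      ... | sides , o∈ , o′∈
        with clique-free⇒covered free no-ladder (Sides.conn-L sides) (Sides.conn-R sides) (Sides.L-apart sides) k {S}
               (∈nb⁺ ∘ Sides.S~L sides) (∈nb⁺ ∘ Sides.S~R sides)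
               (no-clique (All.lookup separators S∈) ∘ clique⇒subset)
      ... | vs , vs≤ , vs∈ , cover = subst (_∈ˡ unions (coverBound k k) (all-traces os)) (sym S≡⋃)
        (∈-unions (here refl) (map piece vs) (All.map⁺ (All.map piece∈ vs∈))
          (ℕ.≤-trans (ℕ.≤-reflexive (List.length-map piece vs)) vs≤))
        where
        piece : Fin n → Subset n
        piece v = S ∩ nb ⁅ v ⁆
        piece∈ : ∀ {v} → v ∈ Sides.L sides ∪ Sides.R sides → piece v ∈ˡ all-traces os
        piece∈ v∈ = ∪-elim
          (λ v∈L → let (y , y∈R) , _ = Sides.conn-R sides in ∈-all-traces {os} {y = y} o∈ (v∈L , y∈R))
          (λ v∈R → let (y , y∈L) , _ = Sides.conn-L sides in ∈-all-traces {os} {y = y} o′∈ (v∈R , y∈L)) v∈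
        S≡⋃ : S ≡ ⋃ (map piece vs)
        S≡⋃ = ⊆-antisym
          (λ t∈ → ∈-⋃⁺ (Any.map⁺ (Any.map (λ t~v → ∩⁺ t∈ (∈nb⁺ (adj⁅⁆⁺ t~v))) (cover t∈))))
          (λ t∈ → let _ , t∈piece = Any.satisfied (Any.map⁻ (∈-⋃⁻ (map piece vs) t∈)) in proj₁ (∩⁻ t∈piece))

    separator-count : ∀ Ss → Unique Ss → All (IsMinimalSeparator G) Ss →
                      length Ss ≤ (1 + n * (n * suc n ^ k)) ^ coverBound k k
    separator-count Ss unique separators = ℕ.≤-trans (unique-⊆⇒length≤ unique (separator∈unions separators))
      (ℕ.≤-trans (length-unions (coverBound k k) _) (ℕ.^-monoˡ-≤ (coverBound k k) (length-all-traces free (oriented separators))))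

-- The polynomial bound on the number of separators.

count-bound : ∀ {n} k h → 2 ≤ n → (1 + n * (n * suc n ^ k)) ^ h ≤ n ^ (2 * ((2 + k) * h))
count-bound {n} k h 2≤n = begin
  (1 + n * (n * suc n ^ k)) ^ h       ≤⟨ ℕ.^-monoˡ-≤ h base ⟩
  ((n ^ 2) ^ (2 + k)) ^ h             ≡⟨ ℕ.^-*-assoc (n ^ 2) (2 + k) h ⟩
  (n ^ 2) ^ ((2 + k) * h)             ≡⟨ ℕ.^-*-assoc n 2 ((2 + k) * h) ⟩
  n ^ (2 * ((2 + k) * h))             ∎
  where
  open ℕ.≤-Reasoning
  double : ∀ a → a + a ≤ n * a
  double a = ℕ.≤-trans (ℕ.≤-reflexive (cong (a +_) (sym (ℕ.+-identityʳ a)))) (ℕ.*-monoˡ-≤ a 2≤n)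
  n*n≡n² : n * n ≡ n ^ 2
  n*n≡n² = cong (n *_) (sym (ℕ.*-identityʳ n))
  1+n≤n² : suc n ≤ n ^ 2
  1+n≤n² = begin
    1 + n ≤⟨ ℕ.+-monoˡ-≤ n (ℕ.≤-trans (ℕ.n≤1+n 1) 2≤n) ⟩
    n + n ≤⟨ double n ⟩
    n * n ≡⟨ n*n≡n² ⟩
    n ^ 2 ∎
  positive : 1 ≤ (n ^ 2) ^ suc k
  positive = begin
    1               ≡⟨ sym (ℕ.^-zeroˡ (suc k)) ⟩
    1 ^ suc k       ≤⟨ ℕ.^-monoˡ-≤ (suc k) (ℕ.≤-trans (s≤s z≤n) 1+n≤n²) ⟩
    (n ^ 2) ^ suc k ∎
  -- For `n` at least 2, the square of `n` absorbs both the successor of `n` and a factor of two.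
  base : 1 + n * (n * suc n ^ k) ≤ (n ^ 2) ^ (2 + k)
  base = begin
    1 + n * (n * suc n ^ k)           ≡⟨ cong suc (sym (ℕ.*-assoc n n (suc n ^ k))) ⟩
    1 + n * n * suc n ^ k             ≤⟨ ℕ.+-mono-≤ positive (ℕ.*-mono-≤ (ℕ.≤-reflexive n*n≡n²) (ℕ.^-monoˡ-≤ k 1+n≤n²)) ⟩
    (n ^ 2) ^ suc k + (n ^ 2) ^ suc k ≤⟨ double ((n ^ 2) ^ suc k) ⟩
    n * (n ^ 2) ^ suc k               ≤⟨ ℕ.*-monoˡ-≤ ((n ^ 2) ^ suc k) (ℕ.≤-trans (ℕ.n≤1+n n) 1+n≤n²) ⟩
    (n ^ 2) ^ (2 + k)                 ∎

-- A separator and a component outside it are both non-empty, which takes two vertices. This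
-- provides the `2 ≤ n` of `count-bound`.
no-separator-in-Fin1 : ∀ {n} {G : Graph (Fin n)} {S} → n ≤ 1 → ¬ IsMinimalSeparator G S
no-separator-in-Fin1 {S = S} (s≤s z≤n) separator =
  let x , x∈S = nonempty ; (y , y∈L) , _ = L.connected
  in x∈∁p⇒x∉p (L.C⊆X y∈L) (subst (_∈ S) (Fin1-≡ x y) x∈S)
  where
  open IsMinimalSeparator separator
  module L = IsComponent L-component
  Fin1-≡ : (x y : Fin 1) → x ≡ y
  Fin1-≡ zero zero = refl
no-separator-in-Fin1 z≤n separator = case proj₁ (IsMinimalSeparator.nonempty separator) of λ ()

theorem4 : (k : ℕ) →
    Tame (λ G → CreatureFree G k
    × ¬ InducedMinor (skinnyLadder k) G
    × NoSeparatorContainsClique G k)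
theorem4 k = 2 * ((2 + k) * coverBound k k) , bound
  where
  bound : ∀ {n} (G : Graph (Fin n)) →
    CreatureFree G k × ¬ InducedMinor (skinnyLadder k) G × NoSeparatorContainsClique G k →
    AtMost (n ^ (2 * ((2 + k) * coverBound k k))) (IsMinimalSeparator G)
  -- The empty list is treated apart, since any listed separator rules out `n ≤ 1`.
  bound G _ [] _ _ = z≤n
  bound {n} G (free , no-ladder , no-clique) Ss@(_ ∷ _) unique separators@(separator ∷ _) with n ℕ.≤? 1
  ... | yes n≤1 = contradiction separator (no-separator-in-Fin1 n≤1)
  ... | no n≰1  = ℕ.≤-trans (separator-count G free (no-ladder ∘ ladder⇒minor G) no-clique Ss unique separators)
                            (count-bound k (coverBound k k) (ℕ.≰⇒> n≰1))
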